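{- Let $G$ be a graph and $k\ge2$. The following are equivalent: (a1) $M_k(G)$ is a non-trivial matroid and $G$ is a cacti-graph; (a2) $M_k(G)$ is a connected matroid.
   Context: Graphs are finite, may have loops and parallel edges, and have no isolated vertices. A leaf is a vertex incident to exactly one edge, which is not a loop. A cacti-graph is a graph with no isolated vertices, no leaves, and no component that is a cycle (equivalently every component has at least two cycles). For $X\subseteq E(G)$, $G\langle X\rangle$ is the subgraph with edge set $X$ and vertex set the vertices incident to $X$. For $k\ge0$, $M_k(G)$ is the matroid on $E(G)$ whose circuits are the inclusion-minimal members of $\{C\subseteq E(G):C\neq\emptyset,\ |C|=|V(G\langle C\rangle)|+k\}$. A matroid is non-trivial if it has at least one circuit and at least one cocircuit; it is connected if its ground set has at least two elements and every two elements lie in a common circuit. -}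

module Defs where

open import Data.Empty using (⊥-elim)
open import Data.Fin.Base using (Fin; zero; suc; inject₁; fromℕ)
open import Data.Fin.Properties using (any?)
  renaming (_≟_ to _≟F_)
open import Data.Fin.Subset
  using (Subset; inside; outside; _∈_; _⊆_; _⊂_; _∪_; _∩_; _-_; ∁; ⁅_⁆; ∣_∣; Nonempty)
  renaming (⊥ to ∅)
open import Data.Fin.Subset.Properties
open import Data.Nat.Base using (ℕ; zero; suc; _+_; _≤_; _<_; s≤s)
open import Data.Nat.Properties
open import Data.Product.Base using (∃; ∃-syntax; _×_; _,_; proj₁; proj₂)
open import Data.Sum.Base using (_⊎_; inj₁; inj₂; [_,_]′)
open import Data.Vec.Base using ([]; _∷_; tabulate)
open import Data.Vec.Properties using ([]=⇒lookup; lookup⇒[]=; lookup∘tabulate)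
open import Function.Base using (_∘_; id)
open import Function.Bundles using (_⇔_)
open import Function.Definitions using (Injective)
open import Level using (0ℓ)
open import Relation.Binary.Construct.Closure.ReflexiveTransitive using (Star)
open import Relation.Binary.PropositionalEquality
open import Relation.Nullary using (¬_; Dec; yes; no; does; contradiction)
open import Relation.Nullary.Decidable using (_×-dec_; _⊎-dec_; ¬?; dec-true)
open import Relation.Unary using (Pred; Decidable)

------------------------------------------------------------------------
-- Minimal and maximal members of a family of subsets

Minimal : ∀ {n} → Pred (Subset n) 0ℓ → Pred (Subset n) 0ℓ
Minimal P X = P X × (∀ Y → P Y → Y ⊆ X → Y ≡ X)

Maximal : ∀ {n} → Pred (Subset n) 0ℓ → Pred (Subset n) 0ℓ
Maximal P X = P X × (∀ Y → P Y → X ⊆ Y → Y ≡ X)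

------------------------------------------------------------------------
-- Matroids, given by their circuits

record Matroid (n : ℕ) : Set₁ where
  field
    Circuit     : Pred (Subset n) 0ℓ
    ∅-noCircuit : ¬ Circuit ∅
    antichain   : ∀ {C D} → Circuit C → Circuit D → C ⊆ D → C ≡ D
    elimination : ∀ {C D} x → Circuit C → Circuit D → C ≢ D → x ∈ C → x ∈ D →
                  ∃[ B ] Circuit B × B ⊆ (C ∪ D) - x

  Independent : Pred (Subset n) 0ℓ
  Independent X = ∀ C → Circuit C → ¬ C ⊆ X

  Base : Pred (Subset n) 0ℓ
  Base = Maximal Independent

  -- The bases of the dual matroid are the complements of the bases.
  CoBase : Pred (Subset n) 0ℓ
  CoBase B = Base (∁ B)

  CoIndependent : Pred (Subset n) 0ℓ
  CoIndependent X = ∃[ B ] CoBase B × X ⊆ B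

  Cocircuit : Pred (Subset n) 0ℓ
  Cocircuit = Minimal (λ X → ¬ CoIndependent X)

  NonTrivial : Set
  NonTrivial = ∃ Circuit × ∃ Cocircuit

  Connected : Set
  Connected = 2 ≤ n × (∀ x y → x ≢ y → ∃[ C ] Circuit C × x ∈ C × y ∈ C)

------------------------------------------------------------------------
-- Graphs: loops and parallel edges are allowed, isolated vertices are not

record Graph : Set where
  field
    #V #E : ℕ
    -- The two ends are listed in an arbitrary order; they coincide for a
    -- loop.  Everything below is insensitive to the order.
    ends  : Fin #E → Fin #V × Fin #V

  Incident : Fin #E → Fin #V → Set
  Incident e v = v ≡ proj₁ (ends e) ⊎ v ≡ proj₂ (ends e)

  field
    noIsolated : ∀ v → ∃[ e ] Incident e v

  incident? : ∀ e v → Dec (Incident e v)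
  incident? e v = (v ≟F proj₁ (ends e)) ⊎-dec (v ≟F proj₂ (ends e))

  Joins : Fin #E → Fin #V → Fin #V → Set
  Joins e u v = ends e ≡ (u , v) ⊎ ends e ≡ (v , u)

  IsLoop : Fin #E → Set
  IsLoop e = proj₁ (ends e) ≡ proj₂ (ends e)

  IsLeaf : Fin #V → Set
  IsLeaf v = ∃[ e ] Incident e v × ¬ IsLoop e × (∀ f → Incident f v → f ≡ e)

  touched? : ∀ X v → Dec (∃[ e ] e ∈ X × Incident e v)
  touched? X v = any? (λ e → (e ∈? X) ×-dec incident? e v)

  -- The vertex set of G⟨X⟩, the subgraph with edge set X.
  V⟨_⟩ : Subset #E → Subset #V
  V⟨ X ⟩ = tabulate (λ v → does (touched? X v))

  record Subgraph : Set where
    field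
      V      : Subset #V
      E      : Subset #E
      closed : ∀ {e v} → e ∈ E → Incident e v → v ∈ V

  open Subgraph public

  _≼_ : Subgraph → Subgraph → Set
  H ≼ K = V H ⊆ V K × E H ⊆ E K

  Adjacent : Subgraph → Fin #V → Fin #V → Set
  Adjacent H u v = ∃[ e ] e ∈ E H × Joins e u v

  IsConnected : Subgraph → Set
  IsConnected H = Nonempty (V H) ×
                  (∀ {u v} → u ∈ V H → v ∈ V H → Star (Adjacent H) u v)

  IsComponent : Subgraph → Set
  IsComponent H = IsConnected H × (∀ K → IsConnected K → H ≼ K → K ≼ H)

  -- v₀ e₀ v₁ e₁ … v_ℓ e_ℓ v₀ with distinct vertices and distinct edges: a
  -- loop is a cycle (ℓ = 0), and so is a pair of parallel edges (ℓ = 1).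
  record IsCycle (H : Subgraph) : Set where
    field
      ℓ           : ℕ
      vertex      : Fin (suc ℓ) → Fin #V
      edge        : Fin (suc ℓ) → Fin #E
      vertex-inj  : Injective _≡_ _≡_ vertex
      edge-inj    : Injective _≡_ _≡_ edge
      consecutive : ∀ i → Joins (edge (inject₁ i)) (vertex (inject₁ i)) (vertex (suc i))
      closing     : Joins (edge (fromℕ ℓ)) (vertex (fromℕ ℓ)) (vertex zero)
      vertices    : ∀ v → v ∈ V H ⇔ (∃[ i ] vertex i ≡ v)
      edges       : ∀ e → e ∈ E H ⇔ (∃[ i ] edge i ≡ e)

  -- Absence of isolated vertices is already part of Graph.
  IsCacti : Set
  IsCacti = (∀ v → ¬ IsLeaf v) × (∀ H → IsComponent H → ¬ IsCycle H)

------------------------------------------------------------------------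
-- The matroid M_k(G)

module _ (k : ℕ) (G : Graph) where
  open Graph G

  Tight : Pred (Subset #E) 0ℓ
  Tight C = Nonempty C × ∣ C ∣ ≡ ∣ V⟨ C ⟩ ∣ + k

  MkCircuit : Pred (Subset #E) 0ℓ
  MkCircuit = Minimal Tight

∣∪∣+∣∩∣ : ∀ {n} (p q : Subset n) → ∣ p ∪ q ∣ + ∣ p ∩ q ∣ ≡ ∣ p ∣ + ∣ q ∣
∣∪∣+∣∩∣ []            []            = refl
∣∪∣+∣∩∣ (outside ∷ p) (outside ∷ q) = ∣∪∣+∣∩∣ p q
∣∪∣+∣∩∣ (outside ∷ p) (inside  ∷ q) = trans (cong suc (∣∪∣+∣∩∣ p q)) (sym (+-suc ∣ p ∣ ∣ q ∣))
∣∪∣+∣∩∣ (inside  ∷ p) (outside ∷ q) = cong suc (∣∪∣+∣∩∣ p q)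
∣∪∣+∣∩∣ (inside  ∷ p) (inside  ∷ q) = cong suc (begin
  ∣ p ∪ q ∣ + suc ∣ p ∩ q ∣    ≡⟨ +-suc ∣ p ∪ q ∣ ∣ p ∩ q ∣ ⟩
  suc (∣ p ∪ q ∣ + ∣ p ∩ q ∣)  ≡⟨ cong suc (∣∪∣+∣∩∣ p q) ⟩
  suc (∣ p ∣ + ∣ q ∣)          ≡⟨ +-suc ∣ p ∣ ∣ q ∣ ⟨
  ∣ p ∣ + suc ∣ q ∣            ∎)
  where open ≡-Reasoning

∣p∣≤1+∣p-x∣ : ∀ {n} (p : Subset n) x → ∣ p ∣ ≤ suc ∣ p - x ∣
∣p∣≤1+∣p-x∣ p x = begin
  ∣ p ∣                                            ≤⟨ p⊆q⇒∣p∣≤∣q∣ cover ⟩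
  ∣ (p - x) ∪ ⁅ x ⁆ ∣                              ≤⟨ m≤m+n _ _ ⟩
  ∣ (p - x) ∪ ⁅ x ⁆ ∣ + ∣ (p - x) ∩ ⁅ x ⁆ ∣        ≡⟨ ∣∪∣+∣∩∣ (p - x) ⁅ x ⁆ ⟩
  ∣ p - x ∣ + ∣ ⁅ x ⁆ ∣                            ≡⟨ cong (∣ p - x ∣ +_) (∣⁅x⁆∣≡1 x) ⟩
  ∣ p - x ∣ + 1                                    ≡⟨ +-comm ∣ p - x ∣ 1 ⟩
  suc ∣ p - x ∣                                    ∎
  where
  open ≤-Reasoning
  cover : p ⊆ (p - x) ∪ ⁅ x ⁆
  cover {y} y∈p with y ≟F x
  ... | yes refl = x∈p∪q⁺ (inj₂ (x∈⁅x⁆ x))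
  ... | no  y≢x  = x∈p∪q⁺ (inj₁ (x∈p∧x≢y⇒x∈p-y y∈p y≢x))

nonempty⇒0<∣p∣ : ∀ {n} {p : Subset n} → Nonempty p → 0 < ∣ p ∣
nonempty⇒0<∣p∣ {p = p} (x , x∈p) = begin
  1          ≡⟨ ∣⁅x⁆∣≡1 x ⟨
  ∣ ⁅ x ⁆ ∣  ≤⟨ p⊆q⇒∣p∣≤∣q∣ (λ y∈ → subst (_∈ p) (sym (x∈⁅y⁆⇒x≡y x y∈)) x∈p) ⟩
  ∣ p ∣      ∎
  where open ≤-Reasoning

0<∣p∣⇒nonempty : ∀ {n} {p : Subset n} → 0 < ∣ p ∣ → Nonempty p
0<∣p∣⇒nonempty {n} {p} 0<p with nonempty? p
... | yes ne = ne
... | no  e  = contradiction (subst (0 <_) (trans (cong ∣_∣ (Empty-unique e)) (∣⊥∣≡0 n)) 0<p) λ()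

-- m bounds the recursion.
∃-minimal : ∀ {n} {P : Pred (Subset n) 0ℓ} → Decidable P →
            ∀ m X → ∣ X ∣ ≤ m → P X → ∃[ C ] Minimal P C × C ⊆ X
∃-minimal P? m X le PX with anySubset? (λ Y → P? Y ×-dec (Y ⊂? X))
... | no none = X , (PX , min) , id
  where
  min : ∀ Y → _ → Y ⊆ X → Y ≡ X
  min Y PY Y⊆X with any? (λ x → (x ∈? X) ×-dec ¬? (x ∈? Y))
  ... | yes (x , x∈X , x∉Y) = contradiction (Y , PY , (λ {_} → Y⊆X) , x , x∈X , x∉Y) none
  ... | no  h = ⊆-antisym Y⊆X X⊆Y
    where
    X⊆Y : X ⊆ Y
    X⊆Y {x} x∈X with x ∈? Y
    ... | yes x∈Y = x∈Y
    ... | no  x∉Y = contradiction (x , x∈X , x∉Y) h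
∃-minimal P? zero X le PX | yes (Y , PY , Y⊂X) =
  contradiction (<-≤-trans (p⊂q⇒∣p∣<∣q∣ Y⊂X) le) λ()
∃-minimal P? (suc m) X le PX | yes (Y , PY , Y⊂X)
  with ∃-minimal P? m Y (m<1+n⇒m≤n (<-≤-trans (p⊂q⇒∣p∣<∣q∣ Y⊂X) le)) PY
... | C , min , C⊆Y = C , min , proj₁ Y⊂X ∘ C⊆Y

module _ (G : Graph) where
  open Graph G

  ∈V⁺ : ∀ {X v e} → e ∈ X → Incident e v → v ∈ V⟨ X ⟩
  ∈V⁺ {X} {v} e∈X inc = lookup⇒[]= v _
    (trans (lookup∘tabulate _ v) (dec-true (touched? X v) (_ , e∈X , inc)))

  ∈V⁻ : ∀ {X v} → v ∈ V⟨ X ⟩ → ∃[ e ] e ∈ X × Incident e v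
  ∈V⁻ {X} {v} v∈ with touched? X v in eq
  ... | yes t = t
  ... | no  _ = contradiction
    (trans (sym ([]=⇒lookup v∈)) (trans (lookup∘tabulate _ v) (cong does eq))) λ()

  V-mono : ∀ {X Y} → X ⊆ Y → V⟨ X ⟩ ⊆ V⟨ Y ⟩
  V-mono X⊆Y v∈ with ∈V⁻ v∈
  ... | e , e∈X , inc = ∈V⁺ (X⊆Y e∈X) inc

  V-submodular : ∀ X Y → ∣ V⟨ X ∪ Y ⟩ ∣ + ∣ V⟨ X ∩ Y ⟩ ∣ ≤ ∣ V⟨ X ⟩ ∣ + ∣ V⟨ Y ⟩ ∣
  V-submodular X Y = begin
    ∣ V⟨ X ∪ Y ⟩ ∣ + ∣ V⟨ X ∩ Y ⟩ ∣                ≤⟨ +-mono-≤ (p⊆q⇒∣p∣≤∣q∣ ∪⊆) (p⊆q⇒∣p∣≤∣q∣ ∩⊆) ⟩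
    ∣ V⟨ X ⟩ ∪ V⟨ Y ⟩ ∣ + ∣ V⟨ X ⟩ ∩ V⟨ Y ⟩ ∣      ≡⟨ ∣∪∣+∣∩∣ V⟨ X ⟩ V⟨ Y ⟩ ⟩
    ∣ V⟨ X ⟩ ∣ + ∣ V⟨ Y ⟩ ∣                        ∎
    where
    open ≤-Reasoning
    ∪⊆ : V⟨ X ∪ Y ⟩ ⊆ V⟨ X ⟩ ∪ V⟨ Y ⟩
    ∪⊆ v∈ with ∈V⁻ v∈
    ... | e , e∈ , inc = x∈p∪q⁺ ([ (λ e∈X → inj₁ (∈V⁺ e∈X inc)) , (λ e∈Y → inj₂ (∈V⁺ e∈Y inc)) ]′
                                  (x∈p∪q⁻ X Y e∈))
    ∩⊆ : V⟨ X ∩ Y ⟩ ⊆ V⟨ X ⟩ ∩ V⟨ Y ⟩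
    ∩⊆ v∈ = x∈p∩q⁺ (V-mono (p∩q⊆p X Y) v∈ , V-mono (p∩q⊆q X Y) v∈)

module _ (k : ℕ) (G : Graph) where
  open Graph G

  tight? : Decidable (Tight k G)
  tight? C = nonempty? C ×-dec (∣ C ∣ ≟ ∣ V⟨ C ⟩ ∣ + k)

  -- Removing an edge from a set X lowers ∣ X ∣ by one and does not raise
  -- ∣ V⟨ X ⟩ ∣, so a set with at least ∣ V⟨ X ⟩ ∣ + k edges contains a tight one.
  dense⇒tight : ∀ m X → ∣ X ∣ ≤ m → Nonempty X → ∣ V⟨ X ⟩ ∣ + k ≤ ∣ X ∣ →
                ∃[ C ] Tight k G C × C ⊆ X
  dense⇒tight m X le ne@(x , x∈X) dense with ∣ X ∣ ≟ ∣ V⟨ X ⟩ ∣ + k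
  ... | yes eq = X , (ne , eq) , id
  dense⇒tight zero X le ne dense | no _ =
    contradiction (<-≤-trans (nonempty⇒0<∣p∣ ne) le) λ()
  dense⇒tight (suc m) X le ne@(x , x∈X) dense | no neq
    with dense⇒tight m X′ (m<1+n⇒m≤n (<-≤-trans (x∈p⇒∣p-x∣<∣p∣ x∈X) le)) X′-ne
           (≤-trans (+-monoˡ-≤ k (p⊆q⇒∣p∣≤∣q∣ (V-mono G X′⊆X))) dense′)
    where
    X′ = X - x
    X′⊆X : X′ ⊆ X
    X′⊆X = p─q⊆p X ⁅ x ⁆
    dense′ : ∣ V⟨ X ⟩ ∣ + k ≤ ∣ X′ ∣
    dense′ = m<1+n⇒m≤n (<-≤-trans (≤∧≢⇒< dense (neq ∘ sym)) (∣p∣≤1+∣p-x∣ X x))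
    X′-ne : Nonempty X′
    X′-ne = 0<∣p∣⇒nonempty (<-≤-trans
      (<-≤-trans (nonempty⇒0<∣p∣ (_ , ∈V⁺ G x∈X (inj₁ refl))) (m≤m+n _ k)) dense′)
  ... | C , tight , C⊆ = C , tight , p─q⊆p X ⁅ x ⁆ ∘ C⊆

  dense⇒circuit : ∀ X → Nonempty X → ∣ V⟨ X ⟩ ∣ + k ≤ ∣ X ∣ → ∃[ C ] MkCircuit k G C × C ⊆ X
  dense⇒circuit X ne dense with dense⇒tight _ X ≤-refl ne dense
  ... | C , tight , C⊆X with ∃-minimal tight? _ C ≤-refl tight
  ...   | D , min , D⊆C = D , min , C⊆X ∘ D⊆C

  proper⇒sparse : ∀ {C} → MkCircuit k G C → ∀ Y → Y ⊆ C → Y ≢ C → Nonempty Y →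
                  ∣ Y ∣ < ∣ V⟨ Y ⟩ ∣ + k
  proper⇒sparse (_ , min) Y Y⊆C Y≢C ne = ≰⇒> λ dense →
    let (Z , tight , Z⊆Y) = dense⇒tight _ Y ≤-refl ne dense
        Z≡C = min Z tight (Y⊆C ∘ Z⊆Y)
    in Y≢C (⊆-antisym Y⊆C (subst (_⊆ Y) Z≡C Z⊆Y))

  Mk-antichain : ∀ {C D} → MkCircuit k G C → MkCircuit k G D → C ⊆ D → C ≡ D
  Mk-antichain {C} (tight , _) (_ , min) C⊆D = min C tight C⊆D

  Mk-elimination : ∀ {C D} x → MkCircuit k G C → MkCircuit k G D → C ≢ D → x ∈ C → x ∈ D →
                   ∃[ B ] MkCircuit k G B × B ⊆ (C ∪ D) - x
  Mk-elimination {C} {D} x cC cD C≢D x∈C x∈D = dense⇒circuit ((C ∪ D) - x) ne dense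
    where
    C⊈D : ¬ C ⊆ D
    C⊈D C⊆D = C≢D (Mk-antichain cC cD C⊆D)

    sparse : ∣ C ∩ D ∣ < ∣ V⟨ C ∩ D ⟩ ∣ + k
    sparse = proper⇒sparse cC (C ∩ D) (p∩q⊆p C D)
      (λ eq → C⊈D (λ y∈C → p∩q⊆q C D (subst (_ ∈_) (sym eq) y∈C)))
      (x , x∈p∩q⁺ (x∈C , x∈D))

    ne : Nonempty ((C ∪ D) - x)
    ne with nonempty? ((C ∪ D) - x)
    ... | yes p = p
    ... | no  e = ⊥-elim (C⊈D C⊆D)
      where
      C⊆D : C ⊆ D
      C⊆D {y} y∈C with y ≟F x
      ... | yes refl = x∈D
      ... | no  y≢x  = contradiction (y , x∈p∧x≢y⇒x∈p-y (x∈p∪q⁺ (inj₁ y∈C)) y≢x) e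

    u i v∪ v∩ a b : ℕ
    u  = ∣ C ∪ D ∣
    i  = ∣ C ∩ D ∣
    v∪ = ∣ V⟨ C ∪ D ⟩ ∣
    v∩ = ∣ V⟨ C ∩ D ⟩ ∣
    a  = ∣ V⟨ C ⟩ ∣
    b  = ∣ V⟨ D ⟩ ∣

    union : suc (v∪ + k) ≤ u
    union = +-cancelʳ-≤ i _ _ (begin
      suc (v∪ + k) + i       ≡⟨ +-suc (v∪ + k) i ⟨
      (v∪ + k) + suc i       ≤⟨ +-monoʳ-≤ (v∪ + k) sparse ⟩
      (v∪ + k) + (v∩ + k)    ≡⟨ swap v∪ v∩ ⟩
      (v∪ + v∩) + (k + k)    ≤⟨ +-monoˡ-≤ (k + k) (V-submodular G C D) ⟩
      (a + b) + (k + k)      ≡⟨ swap a b ⟨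
      (a + k) + (b + k)      ≡⟨ cong₂ _+_ (proj₂ (proj₁ cC)) (proj₂ (proj₁ cD)) ⟨
      ∣ C ∣ + ∣ D ∣          ≡⟨ ∣∪∣+∣∩∣ C D ⟨
      u + i                  ∎)
      where
      open ≤-Reasoning
      open import Algebra.Properties.CommutativeSemigroup +-commutativeSemigroup using (interchange)
      swap : ∀ p q → (p + k) + (q + k) ≡ (p + q) + (k + k)
      swap p q = interchange p k q k

    dense : ∣ V⟨ (C ∪ D) - x ⟩ ∣ + k ≤ ∣ (C ∪ D) - x ∣
    dense = m<1+n⇒m≤n (begin
      suc (∣ V⟨ (C ∪ D) - x ⟩ ∣ + k)  ≤⟨ s≤s (+-monoˡ-≤ k (p⊆q⇒∣p∣≤∣q∣ (V-mono G (p─q⊆p (C ∪ D) ⁅ x ⁆)))) ⟩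
      suc (v∪ + k)                    ≤⟨ union ⟩
      u                               ≤⟨ ∣p∣≤1+∣p-x∣ (C ∪ D) x ⟩
      suc ∣ (C ∪ D) - x ∣             ∎)
      where open ≤-Reasoning

  M : Matroid #E
  M = record
    { Circuit     = MkCircuit k G
    ; ∅-noCircuit = λ ((( _ , x∈∅) , _) , _) → ∉⊥ x∈∅
    ; antichain   = Mk-antichain
    ; elimination = Mk-elimination
    }

{-# OPTIONS --safe #-}

-- M_k(G) is an elongation of the bicircular matroid of G: with ν(X) the largest
-- value of |Y| − |V⟨Y⟩| over Y ⊆ X (the bicircular nullity), its circuits are
-- the sets X with ν(X) = k without coloops, i.e. with ν(X − e) < ν(X) for all
-- e ∈ X.  As ν is supermodular, a non-coloop of X is a non-coloop of every
-- larger set, and if neither x nor y is a coloop of E(G) and 2 ≤ k ≤ ν(E(G)),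
-- then a minimal set X with ν(X) ≥ k in which x and y are non-coloops is a
-- circuit containing both.
--
-- If x is a coloop of E(G), some Y avoiding x attains ν(E(G)), so that at most
-- as many edges as vertices lie outside G⟨Y⟩.  In the absence of leaves these
-- edges and vertices form a non-empty 2-regular graph, and the component of x
-- is a cycle.  Conversely, deleting from a circuit a leaf edge, or all its edges
-- in a component that is a cycle, loses at least as many vertices as edges and
-- leaves a dense set, contradicting minimality.
module Submission where

open import Defs
open import Data.Nat.Base using (ℕ; zero; suc; _+_; _∸_; _≤_; _<_; z≤n; s≤s; s≤s⁻¹)
open import Data.Nat.Properties hiding (0≢1+n)
open import Data.Product.Base using (∃; ∃-syntax; _×_; _,_; proj₁; proj₂)
open import Function.Bundles using (_⇔_; mk⇔; module Equivalence)
open import Algebra.Properties.CommutativeMonoid.Sum +-0-commutativeMonoid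
  using (sum; ∑-distrib-+; ∑-comm; sum-cong-≗; sum-replicate-zero)
open import Algebra.Properties.CommutativeSemigroup using (interchange)
open import Data.Bool.Base using (true; false; if_then_else_)
open import Data.Bool.Properties using () renaming (_≟_ to _≟B_)
open import Data.Fin.Base using (Fin; zero; suc; inject₁; fromℕ; fromℕ<; punchIn)
open import Data.Fin.Induction using (<-weakInduction)
open import Data.Fin.Properties using (any?; injective⇒≤; 0≢1+n; punchInᵢ≢i)
  renaming (_≟_ to _≟F_; suc-injective to sucF-injective)
open import Data.Fin.Relation.Unary.Top using (view; ‵fromℕ; ‵inject₁)
open import Data.Fin.Subset
  using (Subset; inside; outside; _∈_; _∉_; _⊆_; _∪_; _∩_; _-_; _─_; ∁; ⁅_⁆; ∣_∣; Nonempty; ⊤)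
  renaming (⊥ to ∅)
open import Data.Fin.Subset.Properties
open import Data.Sum.Base using (_⊎_; inj₁; inj₂; [_,_]′)
open import Data.Vec.Base using ([]; _∷_; here; there; tabulate; lookup)
open import Data.Vec.Functional using (Vector; updateAt) renaming (_∷_ to _∷ᶠ_)
open import Data.Vec.Functional.Properties using (updateAt-minimal)
open import Data.Vec.Properties using ([]=⇒lookup; lookup⇒[]=; lookup∘tabulate; ≡-dec)
open import Function.Base using (_∘_; id; const)
open import Function.Definitions using (Injective)
open import Level using (0ℓ)
open import Relation.Binary.Construct.Closure.ReflexiveTransitive as Star
  using (Star; ε; _◅_; _◅◅_; reverse)
open import Relation.Binary.PropositionalEquality
open import Relation.Nullary using (¬_; yes; no; does; contradiction)
open import Relation.Nullary.Decidable
  using (_×-dec_; _⊎-dec_; ¬?; map′; decidable-stable; dec-true)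
open import Relation.Unary using (Pred; Decidable)

-- Finite subsets

x∈p─q⇒x∉q : ∀ {n} {x : Fin n} (p q : Subset n) → x ∈ p ─ q → x ∉ q
x∈p─q⇒x∉q (_ ∷ p) (inside  ∷ q) ()         here
x∈p─q⇒x∉q (_ ∷ p) (_       ∷ q) (there x∈) (there x∈q) = x∈p─q⇒x∉q p q x∈ x∈q

x∉p-x : ∀ {n} (p : Subset n) x → x ∉ p - x
x∉p-x p x x∈ = x∈p─q⇒x∉q p ⁅ x ⁆ x∈ (x∈⁅x⁆ x)

p⊆q⇒p-x⊆q-x : ∀ {n} {p q : Subset n} x → p ⊆ q → p - x ⊆ q - x
p⊆q⇒p-x⊆q-x {p = p} x p⊆q {y} y∈ = x∈p∧x≢y⇒x∈p-y (p⊆q (p─q⊆p p ⁅ x ⁆ y∈))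
  (λ y≡x → x∉p-x p x (subst (_∈ p - x) y≡x y∈))

p⊆q∧x∉p⇒p⊆q-x : ∀ {n} {p q : Subset n} {x} → p ⊆ q → x ∉ p → p ⊆ q - x
p⊆q∧x∉p⇒p⊆q-x p⊆q x∉p y∈p = x∈p∧x≢y⇒x∈p-y (p⊆q y∈p) (λ { refl → x∉p y∈p })

p∩[q-x]⊆p-x : ∀ {n} (p q : Subset n) x → p ∩ (q - x) ⊆ p - x
p∩[q-x]⊆p-x p q x {y} y∈ with x∈p∩q⁻ p (q - x) y∈
... | y∈p , y∈q-x = x∈p∧x≢y⇒x∈p-y y∈p (λ { refl → x∉p-x q x y∈q-x })

⊆∧∀∈⇒≡ : ∀ {n} {p q : Subset n} → p ⊆ q → (∀ x → x ∈ q → ¬ x ∉ p) → p ≡ q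
⊆∧∀∈⇒≡ {p = p} p⊆q h = ⊆-antisym p⊆q λ {x} x∈q → decidable-stable (x ∈? p) (h x x∈q)

∣p∣≤∣p─q∣+∣q∣ : ∀ {n} (p q : Subset n) → ∣ p ∣ ≤ ∣ p ─ q ∣ + ∣ q ∣
∣p∣≤∣p─q∣+∣q∣ p q = begin
  ∣ p ∣                                  ≤⟨ p⊆q⇒∣p∣≤∣q∣ cover ⟩
  ∣ (p ─ q) ∪ q ∣                        ≤⟨ m≤m+n _ _ ⟩
  ∣ (p ─ q) ∪ q ∣ + ∣ (p ─ q) ∩ q ∣      ≡⟨ ∣∪∣+∣∩∣ (p ─ q) q ⟩
  ∣ p ─ q ∣ + ∣ q ∣                      ∎
  where
  open ≤-Reasoning
  cover : p ⊆ (p ─ q) ∪ q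
  cover {x} x∈p with x ∈? q
  ... | yes x∈q = x∈p∪q⁺ (inj₂ x∈q)
  ... | no  x∉q = x∈p∪q⁺ (inj₁ (x∈p∧x∉q⇒x∈p─q x∈p x∉q))

disjoint⇒∣p∣+∣q∣≤∣r∣ : ∀ {n} {p q r : Subset n} → p ⊆ r → q ⊆ r → (∀ {x} → x ∈ p → x ∉ q) →
                       ∣ p ∣ + ∣ q ∣ ≤ ∣ r ∣
disjoint⇒∣p∣+∣q∣≤∣r∣ {n} {p} {q} {r} p⊆r q⊆r disj = begin
  ∣ p ∣ + ∣ q ∣              ≡⟨ ∣∪∣+∣∩∣ p q ⟨
  ∣ p ∪ q ∣ + ∣ p ∩ q ∣      ≡⟨ cong (λ z → ∣ p ∪ q ∣ + ∣ z ∣) (Empty-unique empty) ⟩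
  ∣ p ∪ q ∣ + ∣ ∅ {n} ∣      ≡⟨ cong (∣ p ∪ q ∣ +_) (∣⊥∣≡0 n) ⟩
  ∣ p ∪ q ∣ + 0              ≡⟨ +-identityʳ _ ⟩
  ∣ p ∪ q ∣                  ≤⟨ p⊆q⇒∣p∣≤∣q∣ ∪⊆r ⟩
  ∣ r ∣                      ∎
  where
  open ≤-Reasoning
  empty : ¬ Nonempty (p ∩ q)
  empty (x , x∈) with x∈p∩q⁻ p q x∈
  ... | x∈p , x∈q = disj x∈p x∈q
  ∪⊆r : p ∪ q ⊆ r
  ∪⊆r x∈ with x∈p∪q⁻ p q x∈
  ... | inj₁ x∈p = p⊆r x∈p
  ... | inj₂ x∈q = q⊆r x∈q

-- The value `f x x∈p` may be extracted from the membership proof, so `f` is defined on `p` only and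
-- injectivity is asked across all such proofs. The induction removes the image of the first element
-- from `q`.
injection⇒∣p∣≤∣q∣ : ∀ {m n} (p : Subset m) (q : Subset n)
                    (f : ∀ x → x ∈ p → Fin n) →
                    (∀ x x∈p → f x x∈p ∈ q) →
                    (∀ x y x∈p y∈p → f x x∈p ≡ f y y∈p → x ≡ y) →
                    ∣ p ∣ ≤ ∣ q ∣
injection⇒∣p∣≤∣q∣ [] q f f∈q inj = z≤n
injection⇒∣p∣≤∣q∣ (outside ∷ p) q f f∈q inj =
  injection⇒∣p∣≤∣q∣ p q (λ x → f (suc x) ∘ there) (λ x → f∈q (suc x) ∘ there)
    (λ x y x∈ y∈ → sucF-injective ∘ inj (suc x) (suc y) (there x∈) (there y∈))
injection⇒∣p∣≤∣q∣ (inside ∷ p) q f f∈q inj = begin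
  suc ∣ p ∣                      ≤⟨ s≤s ih ⟩
  suc ∣ q - f zero here ∣        ≤⟨ x∈p⇒∣p-x∣<∣p∣ (f∈q zero here) ⟩
  ∣ q ∣                          ∎
  where
  open ≤-Reasoning
  ih : ∣ p ∣ ≤ ∣ q - f zero here ∣
  ih = injection⇒∣p∣≤∣q∣ p _ (λ x → f (suc x) ∘ there)
    (λ x x∈ → x∈p∧x≢y⇒x∈p-y (f∈q (suc x) (there x∈))
      (λ eq → contradiction (inj (suc x) zero (there x∈) here eq) λ()))
    (λ x y x∈ y∈ → sucF-injective ∘ inj (suc x) (suc y) (there x∈) (there y∈))

-- Decidable families of elements and of subsets

module _ {n} {P : Pred (Fin n) 0ℓ} (P? : Decidable P) where

  comprehension : Subset n
  comprehension = tabulate (does ∘ P?)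

  ∈comprehension⁺ : ∀ {x} → P x → x ∈ comprehension
  ∈comprehension⁺ {x} Px = lookup⇒[]= x _ (trans (lookup∘tabulate _ x) (dec-true (P? x) Px))

  ∈comprehension⁻ : ∀ {x} → x ∈ comprehension → P x
  ∈comprehension⁻ {x} x∈ with P? x in eq
  ... | yes Px = Px
  ... | no  _  = contradiction
    (trans (sym ([]=⇒lookup x∈)) (trans (lookup∘tabulate _ x) (cong does eq))) λ()

module _ {n} {P : Pred (Subset n) 0ℓ} (P? : Decidable P) where

  minimal? : Decidable (Minimal P)
  minimal? X = P? X ×-dec
    map′ (λ none Y PY Y⊆X → decidable-stable (≡-dec _≟B_ Y X) (λ Y≢X → none (Y , PY , (λ {_} → Y⊆X) , Y≢X)))
         (λ min (Y , PY , Y⊆X , Y≢X) → Y≢X (min Y PY Y⊆X))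
         (¬? (anySubset? (λ Y → P? Y ×-dec ((Y ⊆? X) ×-dec ¬? (≡-dec _≟B_ Y X)))))

  maximal? : Decidable (Maximal P)
  maximal? X = P? X ×-dec
    map′ (λ none Y PY X⊆Y → decidable-stable (≡-dec _≟B_ Y X) (λ Y≢X → none (Y , PY , (λ {_} → X⊆Y) , Y≢X)))
         (λ max (Y , PY , X⊆Y , Y≢X) → Y≢X (max Y PY X⊆Y))
         (¬? (anySubset? (λ Y → P? Y ×-dec ((X ⊆? Y) ×-dec ¬? (≡-dec _≟B_ Y X)))))

  -- m bounds how much larger than g X a value of g can still be.
  ∃-argmax : (g : Subset n → ℕ) → ∀ m X → P X → (∀ Y → P Y → g Y ≤ m + g X) →
             ∃[ Y ] P Y × (∀ Z → P Z → g Z ≤ g Y)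
  ∃-argmax g m X PX bound with anySubset? (λ Y → P? Y ×-dec (g X <? g Y))
  ... | no none = X , PX , λ Y PY → ≮⇒≥ λ lt → none (Y , PY , lt)
  ∃-argmax g zero X PX bound | yes (Y , PY , lt) = contradiction (bound Y PY) (<⇒≱ lt)
  ∃-argmax g (suc m) X PX bound | yes (Y , PY , lt) = ∃-argmax g m Y PY λ Z PZ → begin
    g Z          ≤⟨ bound Z PZ ⟩
    suc m + g X  ≡⟨ +-suc m (g X) ⟨
    m + suc (g X) ≤⟨ +-monoʳ-≤ m lt ⟩
    m + g Y      ∎
    where open ≤-Reasoning

-- Nullity in the bicircular matroid

module Nullity (G : Graph) where
  open Graph G

  -- Truncation does no harm, because ∅ has excess 0.
  excess : Subset #E → ℕ
  excess Y = ∣ Y ∣ ∸ ∣ V⟨ Y ⟩ ∣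

  densest : ∀ X → ∃[ Y ] Y ⊆ X × (∀ Z → Z ⊆ X → excess Z ≤ excess Y)
  densest X = ∃-argmax {P = _⊆ X} (_⊆? X) excess #E X ⊆-refl λ Y _ →
    ≤-trans (m∸n≤m ∣ Y ∣ ∣ V⟨ Y ⟩ ∣) (≤-trans (∣p∣≤n Y) (m≤m+n #E _))

  abstract
    -- Sealed, so that the search in `densest` never unfolds. The two properties `∣Y∣≤∣V∣+ν` and
    -- `ν-attained` determine `ν` and are all that is used of it later.
    ν : Subset #E → ℕ
    ν X = excess (proj₁ (densest X))

    ∣Y∣≤∣V∣+ν : ∀ {X Y} → Y ⊆ X → ∣ Y ∣ ≤ ∣ V⟨ Y ⟩ ∣ + ν X
    ∣Y∣≤∣V∣+ν {X} {Y} Y⊆X = begin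
      ∣ Y ∣                     ≤⟨ m≤n+m∸n ∣ Y ∣ ∣ V⟨ Y ⟩ ∣ ⟩
      ∣ V⟨ Y ⟩ ∣ + excess Y     ≤⟨ +-monoʳ-≤ ∣ V⟨ Y ⟩ ∣ (proj₂ (proj₂ (densest X)) Y Y⊆X) ⟩
      ∣ V⟨ Y ⟩ ∣ + ν X          ∎
      where open ≤-Reasoning

    ∣V⟨∅⟩∣≡0 : ∣ V⟨ ∅ ⟩ ∣ ≡ 0
    ∣V⟨∅⟩∣≡0 = trans (cong ∣_∣ (Empty-unique λ (v , v∈) → ∉⊥ (proj₁ (proj₂ (∈V⁻ G {∅} v∈))))) (∣⊥∣≡0 #V)

    ν-attained : ∀ X → ∃[ Y ] Y ⊆ X × ∣ Y ∣ ≡ ∣ V⟨ Y ⟩ ∣ + ν X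
    ν-attained X with densest X
    ... | Y , Y⊆X , _ with ≤-total ∣ V⟨ Y ⟩ ∣ ∣ Y ∣
    ...   | inj₁ le = Y , Y⊆X , sym (m+[n∸m]≡n le)
    -- Here the largest truncated excess is 0, which `Y` may attain only by truncation; `∅` attains
    -- it exactly.
    ...   | inj₂ ge = ∅ , ⊥⊆ , trans (∣⊥∣≡0 #E) (sym (cong₂ _+_ ∣V⟨∅⟩∣≡0 (m≤n⇒m∸n≡0 ge)))

  ν-mono : ∀ {X Y} → X ⊆ Y → ν X ≤ ν Y
  ν-mono {X} {Y} X⊆Y with ν-attained X
  ... | Z , Z⊆X , eq = +-cancelˡ-≤ ∣ V⟨ Z ⟩ ∣ _ _ (≤-trans (≤-reflexive (sym eq)) (∣Y∣≤∣V∣+ν (X⊆Y ∘ Z⊆X)))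

  ν≤1+ν- : ∀ X e → ν X ≤ suc (ν (X - e))
  ν≤1+ν- X e with ν-attained X
  ... | Y , Y⊆X , eq = +-cancelˡ-≤ ∣ V⟨ Y ⟩ ∣ _ _ (begin
    ∣ V⟨ Y ⟩ ∣ + ν X                  ≡⟨ eq ⟨
    ∣ Y ∣                             ≤⟨ ∣p∣≤1+∣p-x∣ Y e ⟩
    suc ∣ Y - e ∣                     ≤⟨ s≤s (∣Y∣≤∣V∣+ν (p⊆q⇒p-x⊆q-x e Y⊆X)) ⟩
    suc (∣ V⟨ Y - e ⟩ ∣ + ν (X - e))  ≤⟨ s≤s (+-monoˡ-≤ _ (p⊆q⇒∣p∣≤∣q∣ (V-mono G (p─q⊆p Y ⁅ e ⁆)))) ⟩
    suc (∣ V⟨ Y ⟩ ∣ + ν (X - e))      ≡⟨ +-suc _ _ ⟨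
    ∣ V⟨ Y ⟩ ∣ + suc (ν (X - e))      ∎)
    where open ≤-Reasoning

  -- Edge counts are modular and vertex counts submodular, so the union and the intersection of sets
  -- attaining `ν A` and `ν B` have at least the required total excess.
  ν-supermodular : ∀ A B → ν A + ν B ≤ ν (A ∪ B) + ν (A ∩ B)
  ν-supermodular A B with ν-attained A | ν-attained B
  ... | Y , Y⊆A , eqA | Z , Z⊆B , eqB = +-cancelˡ-≤ (a + b) _ _ (begin
    (a + b) + (ν A + ν B)                    ≡⟨ swap a b (ν A) (ν B) ⟩
    (a + ν A) + (b + ν B)                    ≡⟨ cong₂ _+_ eqA eqB ⟨
    ∣ Y ∣ + ∣ Z ∣                            ≡⟨ ∣∪∣+∣∩∣ Y Z ⟨
    ∣ Y ∪ Z ∣ + ∣ Y ∩ Z ∣                    ≤⟨ +-mono-≤ (∣Y∣≤∣V∣+ν ∪⊆) (∣Y∣≤∣V∣+ν ∩⊆) ⟩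
    (v∪ + ν (A ∪ B)) + (v∩ + ν (A ∩ B))      ≡⟨ swap v∪ v∩ _ _ ⟨
    (v∪ + v∩) + (ν (A ∪ B) + ν (A ∩ B))      ≤⟨ +-monoˡ-≤ _ (V-submodular G Y Z) ⟩
    (a + b) + (ν (A ∪ B) + ν (A ∩ B))        ∎)
    where
    open ≤-Reasoning
    a b v∪ v∩ : ℕ
    a  = ∣ V⟨ Y ⟩ ∣
    b  = ∣ V⟨ Z ⟩ ∣
    v∪ = ∣ V⟨ Y ∪ Z ⟩ ∣
    v∩ = ∣ V⟨ Y ∩ Z ⟩ ∣
    swap = interchange +-commutativeSemigroup
    ∪⊆ : Y ∪ Z ⊆ A ∪ B
    ∪⊆ x∈ with x∈p∪q⁻ Y Z x∈
    ... | inj₁ x∈Y = x∈p∪q⁺ (inj₁ (Y⊆A x∈Y))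
    ... | inj₂ x∈Z = x∈p∪q⁺ (inj₂ (Z⊆B x∈Z))
    ∩⊆ : Y ∩ Z ⊆ A ∩ B
    ∩⊆ x∈ with x∈p∩q⁻ Y Z x∈
    ... | x∈Y , x∈Z = x∈p∩q⁺ (Y⊆A x∈Y , Z⊆B x∈Z)

  -- Equivalently, `e` lies in a bicircular circuit inside `X`. Membership of `e` in `X` is not
  -- demanded, since the strict drop forces it.
  NonColoop : Fin #E → Subset #E → Set
  NonColoop e X = ν (X - e) < ν X

  NonColoop⇒∈ : ∀ {e X} → NonColoop e X → e ∈ X
  NonColoop⇒∈ {e} {X} lt = decidable-stable (e ∈? X) λ e∉X →
    <⇒≱ lt (ν-mono (p⊆q∧x∉p⇒p⊆q-x id e∉X))

  -- Supermodularity for `X` and `Y - e`: deleting `e` costs the larger set at least as much nullity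
  -- as the smaller one.
  NonColoop-mono : ∀ {e X Y} → X ⊆ Y → NonColoop e X → NonColoop e Y
  NonColoop-mono {e} {X} {Y} X⊆Y lt = +-cancelʳ-≤ (ν (X - e)) _ _ (begin
    suc (ν (Y - e)) + ν (X - e)                ≡⟨ +-suc (ν (Y - e)) _ ⟨
    ν (Y - e) + suc (ν (X - e))                ≤⟨ +-monoʳ-≤ (ν (Y - e)) lt ⟩
    ν (Y - e) + ν X                            ≡⟨ +-comm (ν (Y - e)) (ν X) ⟩
    ν X + ν (Y - e)                            ≤⟨ ν-supermodular X (Y - e) ⟩
    ν (X ∪ (Y - e)) + ν (X ∩ (Y - e))          ≤⟨ +-mono-≤ (ν-mono ∪⊆) (ν-mono (p∩[q-x]⊆p-x X Y e)) ⟩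
    ν Y + ν (X - e)                            ∎)
    where
    open ≤-Reasoning
    ∪⊆ : X ∪ (Y - e) ⊆ Y
    ∪⊆ x∈ with x∈p∪q⁻ X (Y - e) x∈
    ... | inj₁ x∈X = X⊆Y x∈X
    ... | inj₂ x∈Y = p─q⊆p Y ⁅ e ⁆ x∈Y

  -- A minimal subset of positive nullity, that is, a bicircular circuit, loses its nullity with any
  -- of its edges; monotonicity carries this up to `Z`.
  ∃-NonColoop : ∀ Z → 0 < ν Z → ∃[ e ] NonColoop e Z
  ∃-NonColoop Z 0<νZ with ∃-minimal (λ Y → 0 <? ν Y) _ Z ≤-refl 0<νZ
  ... | C , (0<νC , min) , C⊆Z with ν-attained C
  ...   | Y , Y⊆C , eq with 0<∣p∣⇒nonempty {p = Y} (<-≤-trans 0<νC (≤-trans (m≤n+m _ _) (≤-reflexive (sym eq))))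
  ...     | e , e∈Y = e , NonColoop-mono C⊆Z (≰⇒> λ le →
    x∉p-x C e (subst (e ∈_) (sym (min (C - e) (<-≤-trans 0<νC le) (p─q⊆p C ⁅ e ⁆))) (Y⊆C e∈Y)))

  -- A subset of `X` with excess `ν X` that missed some `e` would lie in `X - e` and give `e` no
  -- drop in nullity, so it is all of `X`. Applied to a set attaining `ν X` this yields tightness;
  -- applied to a tight subset, minimality.
  coloopless⇒circuit : ∀ {k X} → Nonempty X → ν X ≡ k → (∀ e → e ∈ X → NonColoop e X) →
                       MkCircuit k G X
  coloopless⇒circuit {k} {X} ne refl nc with ν-attained X
  ... | Y , Y⊆X , eq = (ne , trans (cong ∣_∣ (sym Y≡X)) (trans eq (cong (λ Z → ∣ V⟨ Z ⟩ ∣ + k) Y≡X)))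
                     , λ Z (_ , eqZ) Z⊆X → full Z Z⊆X eqZ
    where
    full : ∀ Z → Z ⊆ X → ∣ Z ∣ ≡ ∣ V⟨ Z ⟩ ∣ + ν X → Z ≡ X
    full Z Z⊆X eqZ = ⊆∧∀∈⇒≡ Z⊆X λ e e∈X e∉Z → <⇒≱ (nc e e∈X)
      (+-cancelˡ-≤ ∣ V⟨ Z ⟩ ∣ _ _ (≤-trans (≤-reflexive (sym eqZ)) (∣Y∣≤∣V∣+ν (p⊆q∧x∉p⇒p⊆q-x Z⊆X e∉Z))))
    Y≡X : Y ≡ X
    Y≡X = full Y Y⊆X eq

  -- Only `k ≤ ν X` is required, so that the whole edge set can qualify; equality is recovered from
  -- minimality.
  Candidate : ℕ → Fin #E → Fin #E → Pred (Subset #E) 0ℓ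
  Candidate k x y X = NonColoop x X × NonColoop y X × k ≤ ν X

  candidate? : ∀ k x y → Decidable (Candidate k x y)
  candidate? k x y X = (ν (X - x) <? ν X) ×-dec ((ν (X - y) <? ν X) ×-dec (k ≤? ν X))

  NonColoop-delete-coloop : ∀ {X e z} → NonColoop z X → ν X ≤ ν (X - e) → NonColoop z (X - e)
  NonColoop-delete-coloop {X} {e} {z} ncz le = begin-strict
    ν (X - e - z)  ≤⟨ ν-mono (p⊆q⇒p-x⊆q-x z (p─q⊆p X ⁅ e ⁆)) ⟩
    ν (X - z)      <⟨ ncz ⟩
    ν X            ≤⟨ le ⟩
    ν (X - e)      ∎
    where open ≤-Reasoning

  -- Deleting `z` and then `e` lowers the nullity by two in total. Deleting `e` first accounts for
  -- at most one, so `z` must still lower it afterwards.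
  NonColoop-swap : ∀ {X e z} → NonColoop z X → NonColoop e (X - z) → NonColoop z (X - e)
  NonColoop-swap {X} {e} {z} ncz nce = s≤s⁻¹ chain
    where
    open ≤-Reasoning
    chain : suc (suc (ν (X - e - z))) ≤ suc (ν (X - e))
    chain = begin
      suc (suc (ν (X - e - z)))  ≡⟨ cong (λ Y → suc (suc (ν Y))) (p─x─y≡p─y─x X e z) ⟩
      suc (suc (ν (X - z - e)))  ≤⟨ s≤s nce ⟩
      suc (ν (X - z))            ≤⟨ ncz ⟩
      ν X                        ≤⟨ ν≤1+ν- X e ⟩
      suc (ν (X - e))            ∎

  -- A coloop could be deleted from a minimal candidate, and if its nullity
  -- exceeded k ≥ 2, so could a non-coloop of what remains without x and y.
  minimal-candidate⇒circuit : ∀ {k x y X} → 2 ≤ k → Minimal (Candidate k x y) X → MkCircuit k G X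
  minimal-candidate⇒circuit {k} {x} {y} {X} 2≤k ((ncx , ncy , k≤νX) , min) =
    coloopless⇒circuit (x , NonColoop⇒∈ ncx) (≤-antisym (≮⇒≥ k≮νX) k≤νX) nc
    where
    irreducible : ∀ {e} → e ∈ X → ¬ Candidate k x y (X - e)
    irreducible {e} e∈X cand = x∉p-x X e (subst (e ∈_) (sym (min (X - e) cand (p─q⊆p X ⁅ e ⁆))) e∈X)

    nc : ∀ e → e ∈ X → NonColoop e X
    nc e e∈X = ≰⇒> λ le → irreducible e∈X
      (NonColoop-delete-coloop ncx le , NonColoop-delete-coloop ncy le , ≤-trans k≤νX le)

    k≮νX : ¬ k < ν X
    k≮νX k<νX = irreducible e∈X
      ( NonColoop-swap ncx (NonColoop-mono x-y⊆x nce)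
      , NonColoop-swap ncy (NonColoop-mono x-y⊆y nce)
      , s≤s⁻¹ (≤-trans k<νX (ν≤1+ν- X e)))
      where
      Z : Subset #E
      Z = X - x - y
      -- Since `2 ≤ k < ν X`, the nullity of `X` is at least 3; deleting `x` and `y` costs at most
      -- 2, which leaves a non-coloop `e` in `Z`.
      positive : 3 ≤ suc (suc (ν Z))
      positive = begin
        3                      ≤⟨ s≤s 2≤k ⟩
        suc k                  ≤⟨ k<νX ⟩
        ν X                    ≤⟨ ν≤1+ν- X x ⟩
        suc (ν (X - x))        ≤⟨ s≤s (ν≤1+ν- (X - x) y) ⟩
        suc (suc (ν Z))        ∎
        where open ≤-Reasoning
      nonColoop : ∃[ e ] NonColoop e Z
      nonColoop = ∃-NonColoop Z (s≤s⁻¹ (s≤s⁻¹ positive))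
      e : Fin #E
      e = proj₁ nonColoop
      nce : NonColoop e Z
      nce = proj₂ nonColoop
      x-y⊆x : Z ⊆ X - x
      x-y⊆x = p─q⊆p (X - x) ⁅ y ⁆
      x-y⊆y : Z ⊆ X - y
      x-y⊆y = p⊆q⇒p-x⊆q-x y (p─q⊆p X ⁅ x ⁆)
      e∈X : e ∈ X
      e∈X = p─q⊆p X ⁅ x ⁆ (x-y⊆x (NonColoop⇒∈ nce))

  common-circuit : ∀ {k x y} → 2 ≤ k → k ≤ ν ⊤ → NonColoop x ⊤ → NonColoop y ⊤ →
                   ∃[ C ] MkCircuit k G C × x ∈ C × y ∈ C
  common-circuit {k} {x} {y} 2≤k k≤ν ncx ncy =
    let C , min , _ = ∃-minimal (candidate? k x y) _ ⊤ ≤-refl (ncx , ncy , k≤ν)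
    in C , minimal-candidate⇒circuit 2≤k min , NonColoop⇒∈ (proj₁ (proj₁ min)) , NonColoop⇒∈ (proj₁ (proj₂ (proj₁ min)))

-- Sums of natural numbers over Fin n

sum-mono : ∀ {n} (f g : Vector ℕ n) → (∀ i → f i ≤ g i) → sum f ≤ sum g
sum-mono {zero}  f g f≤g = z≤n
sum-mono {suc n} f g f≤g = +-mono-≤ (f≤g zero) (sum-mono (f ∘ suc) (g ∘ suc) (f≤g ∘ suc))

-- A strict inequality at one index could not be made up for elsewhere. The double counting of
-- degrees is read pointwise through this.
f≤g∧∑g≤∑f⇒g≤f : ∀ {n} (f g : Vector ℕ n) → (∀ i → f i ≤ g i) → sum g ≤ sum f → ∀ i → g i ≤ f i
f≤g∧∑g≤∑f⇒g≤f {suc n} f g f≤g ∑g≤∑f zero = +-cancelʳ-≤ (sum (g ∘ suc)) _ _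
  (≤-trans ∑g≤∑f (+-monoʳ-≤ (f zero) (sum-mono (f ∘ suc) (g ∘ suc) (f≤g ∘ suc))))
f≤g∧∑g≤∑f⇒g≤f {suc n} f g f≤g ∑g≤∑f (suc i) = f≤g∧∑g≤∑f⇒g≤f (f ∘ suc) (g ∘ suc) (f≤g ∘ suc)
  (+-cancelˡ-≤ (g zero) _ _ (≤-trans ∑g≤∑f (+-monoˡ-≤ (sum (f ∘ suc)) (f≤g zero)))) i

-- The extracted term is overwritten by 0 instead of being removed, so further indices can be
-- extracted without renumbering.
sum-extract : ∀ {n} (t : Vector ℕ n) i → sum t ≡ t i + sum (updateAt t i (const 0))
sum-extract t zero    = refl
sum-extract {suc n} t (suc i) = begin
  t zero + sum (t ∘ suc)           ≡⟨ cong (t zero +_) (sum-extract (t ∘ suc) i) ⟩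
  t zero + (t (suc i) + r)         ≡⟨ +-assoc (t zero) _ r ⟨
  (t zero + t (suc i)) + r         ≡⟨ cong (_+ r) (+-comm (t zero) _) ⟩
  (t (suc i) + t zero) + r         ≡⟨ +-assoc (t (suc i)) _ r ⟩
  t (suc i) + (t zero + r)         ∎
  where
  open ≡-Reasoning
  r = sum (updateAt (t ∘ suc) i (const 0))

t[i]≤sum : ∀ {n} (t : Vector ℕ n) i → t i ≤ sum t
t[i]≤sum t i = ≤-trans (m≤m+n (t i) _) (≤-reflexive (sym (sum-extract t i)))

t[i]+t[j]≤sum : ∀ {n} (t : Vector ℕ n) {i j} → j ≢ i → t i + t j ≤ sum t
t[i]+t[j]≤sum t {i} {j} j≢i = begin
  t i + t j     ≡⟨ cong (t i +_) (updateAt-minimal j i t j≢i) ⟨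
  t i + t′ j    ≤⟨ +-monoʳ-≤ (t i) (t[i]≤sum t′ j) ⟩
  t i + sum t′  ≡⟨ sum-extract t i ⟨
  sum t         ∎
  where
  open ≤-Reasoning
  t′ = updateAt t i (const 0)

t[i]+t[j]+t[k]≤sum : ∀ {n} (t : Vector ℕ n) {i j k} → j ≢ i → k ≢ i → k ≢ j → t i + (t j + t k) ≤ sum t
t[i]+t[j]+t[k]≤sum t {i} {j} {k} j≢i k≢i k≢j = begin
  t i + (t j + t k)    ≡⟨ cong (t i +_) (cong₂ _+_ (updateAt-minimal j i t j≢i) (updateAt-minimal k i t k≢i)) ⟨
  t i + (t′ j + t′ k)  ≤⟨ +-monoʳ-≤ (t i) (t[i]+t[j]≤sum t′ k≢j) ⟩
  t i + sum t′         ≡⟨ sum-extract t i ⟨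
  sum t                ∎
  where
  open ≤-Reasoning
  t′ = updateAt t i (const 0)

χ : ∀ {n} → Subset n → Vector ℕ n
χ p i = if lookup p i then 1 else 0

χ≤1 : ∀ {n} (p : Subset n) i → χ p i ≤ 1
χ≤1 p i with lookup p i
... | true  = ≤-refl
... | false = z≤n

x∈p⇒χ≡1 : ∀ {n} {p : Subset n} {i} → i ∈ p → χ p i ≡ 1
x∈p⇒χ≡1 i∈p = cong (if_then 1 else 0) ([]=⇒lookup i∈p)

0<χ⇒x∈p : ∀ {n} {p : Subset n} {i} → 0 < χ p i → i ∈ p
0<χ⇒x∈p {p = p} {i} 0<χ with lookup p i in eq
... | true = lookup⇒[]= i p eq

x∉p⇒χ≡0 : ∀ {n} {p : Subset n} {i} → i ∉ p → χ p i ≡ 0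
x∉p⇒χ≡0 {p = p} {i} i∉p with lookup p i in eq
... | true  = contradiction (lookup⇒[]= i p eq) i∉p
... | false = refl

sum-χ : ∀ {n} (p : Subset n) → sum (χ p) ≡ ∣ p ∣
sum-χ []            = refl
sum-χ (outside ∷ p) = sum-χ p
sum-χ (inside  ∷ p) = cong suc (sum-χ p)

sum-point : ∀ {n} (u : Fin n) c → sum (λ w → if does (u ≟F w) then c else 0) ≡ c
sum-point {suc n} zero    c = trans (cong (c +_) (sum-replicate-zero n)) (+-identityʳ c)
sum-point {suc n} (suc u) c = sum-point u c

∣p∣+∣∁p∣≡n : ∀ {n} (p : Subset n) → ∣ p ∣ + ∣ ∁ p ∣ ≡ n
∣p∣+∣∁p∣≡n p = trans (cong (∣ p ∣ +_) (∣∁p∣≡n∸∣p∣ p)) (m+[n∸m]≡n (∣p∣≤n p))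

-- Edges, degrees and cycles

module GraphBasics (G : Graph) where
  open Graph G

  otherEnd : ∀ {e v} → Incident e v → ∃[ u ] Joins e u v
  otherEnd (inj₁ refl) = _ , inj₂ refl
  otherEnd (inj₂ refl) = _ , inj₁ refl

  Joins-sym : ∀ {e u v} → Joins e u v → Joins e v u
  Joins-sym (inj₁ eq) = inj₂ eq
  Joins-sym (inj₂ eq) = inj₁ eq

  Joins⇒Incident : ∀ {e u v} → Joins e u v → Incident e u
  Joins⇒Incident (inj₁ eq) = inj₁ (sym (cong proj₁ eq))
  Joins⇒Incident (inj₂ eq) = inj₂ (sym (cong proj₂ eq))

  Joins-Incident : ∀ {e u v w} → Joins e u v → Incident e w → w ≡ u ⊎ w ≡ v
  Joins-Incident (inj₁ eq) (inj₁ refl) = inj₁ (cong proj₁ eq)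
  Joins-Incident (inj₁ eq) (inj₂ refl) = inj₂ (cong proj₂ eq)
  Joins-Incident (inj₂ eq) (inj₁ refl) = inj₂ (cong proj₁ eq)
  Joins-Incident (inj₂ eq) (inj₂ refl) = inj₁ (cong proj₂ eq)

  Joins-refl⇒IsLoop : ∀ {e u} → Joins e u u → IsLoop e
  Joins-refl⇒IsLoop (inj₁ eq) = trans (cong proj₁ eq) (sym (cong proj₂ eq))
  Joins-refl⇒IsLoop (inj₂ eq) = trans (cong proj₁ eq) (sym (cong proj₂ eq))

  IsLoop⇒≡ : ∀ {e u v} → Joins e u v → IsLoop e → u ≡ v
  IsLoop⇒≡ (inj₁ eq) loop = trans (sym (cong proj₁ eq)) (trans loop (cong proj₂ eq))
  IsLoop⇒≡ (inj₂ eq) loop = trans (sym (cong proj₂ eq)) (trans (sym loop) (cong proj₁ eq))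

  Adjacent-sym : ∀ (H : Subgraph) {u v} → Adjacent H u v → Adjacent H v u
  Adjacent-sym H (e , e∈ , joins) = e , e∈ , Joins-sym joins

  second-edge : ∀ {e v} → ¬ IsLeaf v → Incident e v → ¬ IsLoop e → ∃[ f ] f ≢ e × Incident f v
  second-edge {e} {v} ¬leaf inc ¬loop with any? (λ f → ¬? (f ≟F e) ×-dec incident? f v)
  ... | yes p = p
  ... | no  h = contradiction
    (e , inc , ¬loop , λ f inc-f → decidable-stable (f ≟F e) (λ f≢e → h (f , f≢e , inc-f))) ¬leaf

  -- Degree two without counting: given `noIsolated`, the first field bounds degrees from below, and
  -- the next two from above, a loop counting twice. The last makes `W` a union of vertex sets of
  -- components.
  record TwoRegular (W : Subset #V) : Set where
    field
      no-leaf  : ∀ {w} → w ∈ W → ¬ IsLeaf w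
      loop     : ∀ {w e f} → w ∈ W → IsLoop e → Incident e w → Incident f w → f ≡ e
      no-third : ∀ {w e f g} → w ∈ W → Incident e w → Incident f w → Incident g w →
                 f ≢ e → g ≢ e → g ≡ f
      ends⊆    : ∀ {w e v} → w ∈ W → Incident e w → Incident e v → v ∈ W

  -- Every vertex of W has degree at least two and S has at most ∣ W ∣ edges, so
  -- double counting forces degree two, and both ends of each edge of S into W.
  module Degrees (noLeaf : ∀ v → ¬ IsLeaf v) (W : Subset #V) (S : Subset #E)
    (W-edges⊆S : ∀ {e v} → v ∈ W → Incident e v → e ∈ S) (∣S∣≤∣W∣ : ∣ S ∣ ≤ ∣ W ∣) where

    -- The share of an edge end `u` in the degree of `w`, which vanishes outside `W`. The weight is
    -- `χ W u` and not `χ W w` so that `sum-point` meets a constant when summing over `w`.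
    half : Fin #V → Fin #V → ℕ
    half w u = if does (u ≟F w) then χ W u else 0

    incidence : Fin #V → Fin #E → ℕ
    incidence w e = half w (proj₁ (ends e)) + half w (proj₂ (ends e))

    degree : Fin #V → ℕ
    degree w = sum (incidence w)

    endsIn : Fin #E → ℕ
    endsIn e = χ W (proj₁ (ends e)) + χ W (proj₂ (ends e))

    half≡1 : ∀ {w} → w ∈ W → half w w ≡ 1
    half≡1 {w} w∈W = trans (cong (if_then χ W w else 0) (dec-true (w ≟F w) refl)) (x∈p⇒χ≡1 w∈W)

    1≤incidence : ∀ {w e} → w ∈ W → Incident e w → 1 ≤ incidence w e
    1≤incidence w∈W (inj₁ refl) = ≤-trans (≤-reflexive (sym (half≡1 w∈W))) (m≤m+n _ _)
    1≤incidence w∈W (inj₂ refl) = ≤-trans (≤-reflexive (sym (half≡1 w∈W))) (m≤n+m _ _)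

    2≤incidence : ∀ {w e} → w ∈ W → IsLoop e → Incident e w → 2 ≤ incidence w e
    2≤incidence {w} {e} w∈W isLoop inc =
      ≤-reflexive (sym (cong₂ _+_ (at (proj₁ both)) (at (proj₂ both))))
      where
      both : w ≡ proj₁ (ends e) × w ≡ proj₂ (ends e)
      both = [ (λ eq → eq , trans eq isLoop) , (λ eq → trans eq (sym isLoop) , eq) ]′ inc
      at : ∀ {u} → w ≡ u → half w u ≡ 1
      at refl = half≡1 w∈W

    2≤degree : ∀ {w} → w ∈ W → 2 ≤ degree w
    2≤degree {w} w∈W = helper (noIsolated w)
      where
      helper : ∃[ e ] Incident e w → 2 ≤ degree w
      helper (e , inc) with proj₁ (ends e) ≟F proj₂ (ends e)
      ... | yes isLoop = ≤-trans (2≤incidence w∈W isLoop inc) (t[i]≤sum (incidence w) e)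
      ... | no  ¬loop  =
        let f , f≢e , inc-f = second-edge (noLeaf w) inc ¬loop
        in ≤-trans (+-mono-≤ (1≤incidence w∈W inc) (1≤incidence w∈W inc-f)) (t[i]+t[j]≤sum (incidence w) f≢e)

    2χ≤degree : ∀ w → χ W w + χ W w ≤ degree w
    2χ≤degree w with w ∈? W
    ... | yes w∈W = ≤-trans (≤-reflexive (cong₂ _+_ (x∈p⇒χ≡1 w∈W) (x∈p⇒χ≡1 w∈W))) (2≤degree w∈W)
    ... | no  w∉W = ≤-trans (≤-reflexive (cong₂ _+_ (x∉p⇒χ≡0 w∉W) (x∉p⇒χ≡0 w∉W))) z≤n

    endsIn≤2χ : ∀ e → endsIn e ≤ χ S e + χ S e
    endsIn≤2χ e with e ∈? S
    ... | yes e∈S = ≤-trans (+-mono-≤ (χ≤1 W _) (χ≤1 W _)) (≤-reflexive (sym (cong₂ _+_ (x∈p⇒χ≡1 e∈S) (x∈p⇒χ≡1 e∈S))))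
    ... | no  e∉S = ≤-trans (≤-reflexive (cong₂ _+_ (x∉p⇒χ≡0 (λ v∈W → e∉S (W-edges⊆S v∈W (inj₁ refl))))
                                                    (x∉p⇒χ≡0 (λ v∈W → e∉S (W-edges⊆S v∈W (inj₂ refl)))))) z≤n

    handshake : sum degree ≡ sum endsIn
    handshake = trans (∑-comm incidence) (sum-cong-≗ λ e →
      trans (∑-distrib-+ (λ w → half w (proj₁ (ends e))) (λ w → half w (proj₂ (ends e))))
            (cong₂ _+_ (sum-point (proj₁ (ends e)) _) (sum-point (proj₂ (ends e)) _)))

    sum-2χ : ∀ {n} (p : Subset n) → sum (λ i → χ p i + χ p i) ≡ ∣ p ∣ + ∣ p ∣
    sum-2χ p = trans (∑-distrib-+ (χ p) (χ p)) (cong₂ _+_ (sum-χ p) (sum-χ p))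

    2∣S∣≤2∣W∣ : sum (λ e → χ S e + χ S e) ≤ sum (λ w → χ W w + χ W w)
    2∣S∣≤2∣W∣ = begin
      sum (λ e → χ S e + χ S e)  ≡⟨ sum-2χ S ⟩
      ∣ S ∣ + ∣ S ∣              ≤⟨ +-mono-≤ ∣S∣≤∣W∣ ∣S∣≤∣W∣ ⟩
      ∣ W ∣ + ∣ W ∣              ≡⟨ sum-2χ W ⟨
      sum (λ w → χ W w + χ W w)  ∎
      where open ≤-Reasoning

    -- The chain 2∣W∣ ≤ sum of degrees = sum of `endsIn` ≤ 2∣S∣ ≤ 2∣W∣ closes up, so it holds with
    -- equality at every vertex.
    degree≤2 : ∀ w → degree w ≤ 2
    degree≤2 w = ≤-trans
      (f≤g∧∑g≤∑f⇒g≤f (λ w → χ W w + χ W w) degree 2χ≤degree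
        (≤-trans (≤-reflexive handshake) (≤-trans (sum-mono endsIn _ endsIn≤2χ) 2∣S∣≤2∣W∣)) w)
      (+-mono-≤ (χ≤1 W w) (χ≤1 W w))

    -- The same closed chain read at the edges: an edge of `S` has both of its two ends counted in
    -- `W`.
    S-ends⊆W : ∀ {e v} → e ∈ S → Incident e v → v ∈ W
    S-ends⊆W {e} {v} e∈S inc = 0<χ⇒x∈p (in-W inc)
      where
      2≤endsIn : 2 ≤ endsIn e
      2≤endsIn = ≤-trans (≤-reflexive (sym (cong₂ _+_ (x∈p⇒χ≡1 e∈S) (x∈p⇒χ≡1 e∈S))))
        (f≤g∧∑g≤∑f⇒g≤f endsIn (λ e → χ S e + χ S e) endsIn≤2χ
          (≤-trans 2∣S∣≤2∣W∣ (≤-trans (sum-mono _ degree 2χ≤degree) (≤-reflexive handshake))) e)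
      in-W : ∀ {v} → Incident e v → 0 < χ W v
      in-W (inj₁ refl) = +-cancelʳ-≤ 1 _ _ (≤-trans 2≤endsIn (+-monoʳ-≤ _ (χ≤1 W _)))
      in-W (inj₂ refl) = +-cancelˡ-≤ 1 _ _ (≤-trans 2≤endsIn (+-monoˡ-≤ _ (χ≤1 W _)))

    twoRegular : TwoRegular W
    twoRegular = record
      { no-leaf  = λ {w} _ → noLeaf w
      ; loop     = λ {w} {e} {f} w∈W isLoop inc-e inc-f → decidable-stable (f ≟F e) λ f≢e →
          contradiction (degree≤2 w) (<⇒≱ (≤-trans
            (+-mono-≤ (2≤incidence w∈W isLoop inc-e) (1≤incidence w∈W inc-f)) (t[i]+t[j]≤sum (incidence w) f≢e)))
      ; no-third = λ {w} {e} {f} {g} w∈W inc-e inc-f inc-g f≢e g≢e → decidable-stable (g ≟F f) λ g≢f →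
          contradiction (degree≤2 w) (<⇒≱ (≤-trans
            (+-mono-≤ (1≤incidence w∈W inc-e) (+-mono-≤ (1≤incidence w∈W inc-f) (1≤incidence w∈W inc-g)))
            (t[i]+t[j]+t[k]≤sum (incidence w) f≢e g≢e g≢f)))
      ; ends⊆    = λ w∈W inc-w inc-v → S-ends⊆W (W-edges⊆S w∈W inc-w) inc-v
      }

-- From a two-regular vertex set to a component that is a cycle

∷-injective : ∀ {A : Set} {n} {x : A} {xs : Vector A n} → (∀ i → xs i ≢ x) → Injective _≡_ _≡_ xs →
              Injective _≡_ _≡_ (x ∷ᶠ xs)
∷-injective fresh inj {zero}  {zero}  eq = refl
∷-injective fresh inj {zero}  {suc j} eq = contradiction (sym eq) (fresh j)
∷-injective fresh inj {suc i} {zero}  eq = contradiction eq (fresh i)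
∷-injective fresh inj {suc i} {suc j} eq = cong suc (inj eq)

inject₁≢suc : ∀ {n} (i : Fin n) → inject₁ i ≢ suc i
inject₁≢suc (suc i) eq = inject₁≢suc i (sucF-injective eq)

module Cycles (G : Graph) where
  open Graph G
  open GraphBasics G

  module _ {W : Subset #V} (twoRegular : TwoRegular W) where
    open TwoRegular twoRegular

    -- A path v₀ e₀ v₁ … v_ℓ in W whose last edge e_ℓ dangles from v_ℓ
    -- towards b; it is extended at v₀ until b is reached.
    record Path (b : Fin #V) (ℓ : ℕ) : Set where
      field
        vertex      : Fin (suc ℓ) → Fin #V
        edge        : Fin (suc ℓ) → Fin #E
        vertex-inj  : Injective _≡_ _≡_ vertex
        edge-inj    : Injective _≡_ _≡_ edge
        consecutive : ∀ i → Joins (edge (inject₁ i)) (vertex (inject₁ i)) (vertex (suc i))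
        dangling    : Joins (edge (fromℕ ℓ)) (vertex (fromℕ ℓ)) b
        inW         : ∀ i → vertex i ∈ W

      edge-joins : ∀ i → ∃[ u ] Joins (edge i) (vertex i) u × (u ≡ b ⊎ ∃[ j ] inject₁ j ≡ i × vertex (suc j) ≡ u)
      edge-joins i with view i
      ... | ‵fromℕ     = b , dangling , inj₁ refl
      ... | ‵inject₁ j = vertex (suc j) , consecutive j , inj₂ (j , refl , refl)

      edge-incident : ∀ i → Incident (edge i) (vertex i)
      edge-incident i = Joins⇒Incident (proj₁ (proj₂ (edge-joins i)))

    singleton : ∀ e → proj₁ (ends e) ∈ W → Path (proj₂ (ends e)) 0
    singleton e a∈W = record
      { vertex      = const (proj₁ (ends e))
      ; edge        = const e
      ; vertex-inj  = λ { {zero} {zero} _ → refl }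
      ; edge-inj    = λ { {zero} {zero} _ → refl }
      ; consecutive = λ ()
      ; dangling    = inj₁ refl
      ; inW         = const a∈W
      }

    -- As `b` is not yet reached, the first edge is no loop and is the only path edge at `v₀`, so a
    -- second edge `f` at `v₀` is new. Its other end `u` is new too: at `v₀` it would make `f` a
    -- loop beside the first edge, and every later vertex already has two path edges, the dangling
    -- one included.
    extend : ∀ {b ℓ} (p : Path b ℓ) → Path.vertex p zero ≢ b → Path b (suc ℓ)
    extend {b} {ℓ} p v₀≢b = record
      { vertex      = u ∷ᶠ vertex
      ; edge        = f ∷ᶠ edge
      ; vertex-inj  = ∷-injective u-fresh vertex-inj
      ; edge-inj    = ∷-injective (λ i eq → f-fresh i (sym eq)) edge-inj
      ; consecutive = λ { zero → f-joins ; (suc i) → consecutive i }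
      ; dangling    = dangling
      ; inW         = λ { zero → ends⊆ (inW zero) f-inc (Joins⇒Incident f-joins) ; (suc i) → inW i }
      }
      where
      open Path p
      v₀ = vertex zero

      e₀-not-loop : ¬ IsLoop (edge zero)
      e₀-not-loop isLoop with edge-joins zero
      ... | _ , joins , inj₁ refl            = v₀≢b (IsLoop⇒≡ joins isLoop)
      ... | _ , joins , inj₂ (j , _ , refl)  = 0≢1+n (vertex-inj (IsLoop⇒≡ joins isLoop))

      only-e₀ : ∀ i → Incident (edge i) v₀ → i ≡ zero
      only-e₀ i inc with edge-joins i
      ... | _ , joins , end with Joins-Incident joins inc | end
      ...   | inj₁ eq | _                        = sym (vertex-inj eq)
      ...   | inj₂ eq | inj₁ refl                = contradiction eq v₀≢b
      ...   | inj₂ eq | inj₂ (j , _ , refl)      = contradiction (vertex-inj eq) 0≢1+n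

      next : ∃[ f ] f ≢ edge zero × Incident f v₀
      next = second-edge (no-leaf (inW zero)) (edge-incident zero) e₀-not-loop
      f = proj₁ next
      f≢e₀ = proj₁ (proj₂ next)
      f-inc = proj₂ (proj₂ next)
      u = proj₁ (otherEnd f-inc)
      f-joins : Joins f u v₀
      f-joins = proj₂ (otherEnd f-inc)

      f-fresh : ∀ i → f ≢ edge i
      f-fresh i eq = f≢e₀ (trans eq (cong edge (only-e₀ i (subst (λ e → Incident e v₀) eq f-inc))))

      u-fresh : ∀ i → vertex i ≢ u
      u-fresh zero    eq = f≢e₀ (sym (loop (inW zero)
        (Joins-refl⇒IsLoop (subst (λ w → Joins f w v₀) (sym eq) f-joins)) f-inc (edge-incident zero)))
      u-fresh (suc j) eq = f-fresh (suc j) (no-third (inW (suc j))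
        (Joins⇒Incident (Joins-sym (consecutive j))) (edge-incident (suc j))
        (subst (Incident f) (sym eq) (Joins⇒Incident f-joins))
        (λ e≡ → inject₁≢suc j (sym (edge-inj e≡))) (f-fresh (inject₁ j)))

    -- A path has at most #V vertices, so m bounds the number of extensions.
    close : ∀ {b ℓ} m → #V ≤ m + ℓ → Path b ℓ → ∃[ ℓ′ ] ∃[ p ] Path.vertex {b} {ℓ′} p zero ≡ b
    close {b} {ℓ} m bound p with Path.vertex p zero ≟F b
    ... | yes eq = ℓ , p , eq
    close {b} {ℓ} zero    bound p | no _ = contradiction (injective⇒≤ (Path.vertex-inj p)) (<⇒≱ (s≤s bound))
    close {b} {ℓ} (suc m) bound p | no v₀≢b =
      close m (≤-trans bound (≤-reflexive (sym (+-suc m ℓ)))) (extend p v₀≢b)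

    module ClosedPath {b ℓ} (p : Path b ℓ) (v₀≡b : Path.vertex p zero ≡ b) where
      open Path p

      closing : Joins (edge (fromℕ ℓ)) (vertex (fromℕ ℓ)) (vertex zero)
      closing = subst (Joins _ _) (sym v₀≡b) dangling

      onPath? : Decidable (λ v → ∃[ i ] vertex i ≡ v)
      onPath? v = any? (λ i → vertex i ≟F v)

      edgeOnPath? : Decidable (λ e → ∃[ i ] edge i ≡ e)
      edgeOnPath? e = any? (λ i → edge i ≟F e)

      next-vertex : ∀ i → ∃[ j ] Joins (edge i) (vertex i) (vertex j)
      next-vertex i with view i
      ... | ‵fromℕ     = zero , closing
      ... | ‵inject₁ j = suc j , consecutive j

      cycle : Subgraph
      cycle = record
        { V      = comprehension onPath?
        ; E      = comprehension edgeOnPath?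
        ; closed = λ e∈ inc → ∈comprehension⁺ onPath? (ends-on-path (∈comprehension⁻ edgeOnPath? e∈) inc)
        }
        where
        ends-on-path : ∀ {e v} → ∃[ i ] edge i ≡ e → Incident e v → ∃[ i ] vertex i ≡ v
        ends-on-path (i , refl) inc with next-vertex i
        ... | j , joins with Joins-Incident joins inc
        ...   | inj₁ refl = i , refl
        ...   | inj₂ refl = j , refl

      isCycle : IsCycle cycle
      isCycle = record
        { ℓ           = ℓ
        ; vertex      = vertex
        ; edge        = edge
        ; vertex-inj  = vertex-inj
        ; edge-inj    = edge-inj
        ; consecutive = consecutive
        ; closing     = closing
        ; vertices    = λ v → mk⇔ (∈comprehension⁻ onPath?) (∈comprehension⁺ onPath?)
        ; edges       = λ e → mk⇔ (∈comprehension⁻ edgeOnPath?) (∈comprehension⁺ edgeOnPath?)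
        }

      -- The loop alternative covers `ℓ = 0`, where the closing edge would be its own predecessor.
      previous-edge : ∀ i → IsLoop (edge i) ⊎ (∃[ j ] j ≢ i × Incident (edge j) (vertex i))
      previous-edge (suc j) = inj₂ (inject₁ j , inject₁≢suc j , Joins⇒Incident (Joins-sym (consecutive j)))
      previous-edge zero with fromℕ ℓ ≟F zero
      ... | yes eq = inj₁ (Joins-refl⇒IsLoop (subst (λ i → Joins (edge i) (vertex i) (vertex zero)) eq closing))
      ... | no  ne = inj₂ (fromℕ ℓ , ne , Joins⇒Incident (Joins-sym closing))

      -- The loop, or the two path edges, at a vertex of the path use up its degree.
      edges-at-path : ∀ {e} i → Incident e (vertex i) → ∃[ j ] edge j ≡ e
      edges-at-path {e} i inc with previous-edge i
      ... | inj₁ isLoop = i , sym (loop (inW i) isLoop (edge-incident i) inc)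
      ... | inj₂ (j , j≢i , inc-j) with e ≟F edge j
      ...   | yes eq = j , sym eq
      ...   | no  ne = i , sym (no-third (inW i) inc-j (edge-incident i) inc (λ eq → j≢i (sym (edge-inj eq))) ne)

      reach-zero : ∀ i → Star (Adjacent cycle) (vertex i) (vertex zero)
      reach-zero = <-weakInduction _ ε λ i path →
        (edge (inject₁ i) , ∈comprehension⁺ edgeOnPath? (_ , refl) , Joins-sym (consecutive i)) ◅ path

      isConnected : IsConnected cycle
      isConnected = (vertex zero , ∈comprehension⁺ onPath? (_ , refl)) , λ u∈ v∈ →
        connect (∈comprehension⁻ onPath? u∈) (∈comprehension⁻ onPath? v∈)
        where
        connect : ∀ {u v} → ∃[ i ] vertex i ≡ u → ∃[ i ] vertex i ≡ v → Star (Adjacent cycle) u v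
        connect (i , refl) (j , refl) = reach-zero i ◅◅ reverse (Adjacent-sym cycle) (reach-zero j)

      E-saturated : ∀ {e v} → v ∈ V cycle → Incident e v → e ∈ E cycle
      E-saturated v∈ inc with ∈comprehension⁻ onPath? v∈
      ... | i , refl = ∈comprehension⁺ edgeOnPath? (edges-at-path i inc)

      -- A walk in a larger connected subgraph cannot leave the cycle, because every edge at a cycle
      -- vertex is a cycle edge.
      isComponent : IsComponent cycle
      isComponent = isConnected , λ K (_ , K-connected) (V⊆ , E⊆) →
        let v₀∈ = ∈comprehension⁺ onPath? (zero , refl)
            V⊇ : V K ⊆ V cycle
            V⊇ v∈ = stay K (K-connected (V⊆ v₀∈) v∈) v₀∈
        in (λ {v} → V⊇ {v}) , λ {e} e∈ → E-saturated (V⊇ (Subgraph.closed K e∈ (inj₁ refl))) (inj₁ refl)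
        where
        stay : ∀ K {u v} → Star (Adjacent K) u v → u ∈ V cycle → v ∈ V cycle
        stay K ε u∈ = u∈
        stay K ((e , _ , joins) ◅ path) u∈ = stay K path
          (Subgraph.closed cycle (E-saturated u∈ (Joins⇒Incident joins)) (Joins⇒Incident (Joins-sym joins)))

    cycle-component : ∀ e → proj₁ (ends e) ∈ W → ∃[ H ] IsComponent H × IsCycle H
    cycle-component e a∈W with close #V (m≤m+n #V 0) (singleton e a∈W)
    ... | _ , p , eq = ClosedPath.cycle p eq , ClosedPath.isComponent p eq , ClosedPath.isCycle p eq

  -- Cacti-graphs have no coloops

  open Nullity G

  cacti⇒NonColoop : IsCacti → ∀ x → NonColoop x ⊤
  cacti⇒NonColoop (noLeaf , noCycle) x = ≰⇒> λ le →
    -- If `x` is a coloop, `Y` avoids `x` and still has excess at least `ν ⊤`. The leftover edges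
    -- `S` and vertices `W` then meet the conditions of `Degrees`, and `x` provides an edge to start
    -- from.
    let Y , Y⊆ , eq = ν-attained (⊤ - x)
        S = ∁ Y
        W = ∁ V⟨ Y ⟩
        W-edges⊆S : ∀ {e v} → v ∈ W → Incident e v → e ∈ S
        W-edges⊆S = λ v∈W inc → x∉p⇒x∈∁p λ e∈Y → x∈∁p⇒x∉p v∈W (∈V⁺ G e∈Y inc)
        x∈S : x ∈ S
        x∈S = x∉p⇒x∈∁p λ x∈Y → x∉p-x ⊤ x (Y⊆ x∈Y)
        module D = Degrees noLeaf W S W-edges⊆S (∣S∣≤∣W∣ Y le eq)
        H , isComp , isCyc = cycle-component D.twoRegular x (D.S-ends⊆W x∈S (inj₁ refl))
    in noCycle H isComp isCyc
    where
    ∣S∣≤∣W∣ : ∀ Y → ν ⊤ ≤ ν (⊤ - x) → ∣ Y ∣ ≡ ∣ V⟨ Y ⟩ ∣ + ν (⊤ - x) → ∣ ∁ Y ∣ ≤ ∣ ∁ V⟨ Y ⟩ ∣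
    -- By `eq`, the cancelled `a + n` is `∣ Y ∣`.
    ∣S∣≤∣W∣ Y le eq = +-cancelˡ-≤ (a + n) _ _ (begin
      (a + n) + ∣ ∁ Y ∣            ≡⟨ cong (_+ ∣ ∁ Y ∣) eq ⟨
      ∣ Y ∣ + ∣ ∁ Y ∣              ≡⟨ ∣p∣+∣∁p∣≡n Y ⟩
      #E                           ≡⟨ ∣⊤∣≡n #E ⟨
      ∣ ⊤ {#E} ∣                   ≤⟨ ∣Y∣≤∣V∣+ν ⊆-refl ⟩
      ∣ V⟨ ⊤ ⟩ ∣ + ν ⊤             ≤⟨ +-mono-≤ (∣p∣≤n V⟨ ⊤ ⟩) le ⟩
      #V + n                       ≡⟨ cong (_+ n) (∣p∣+∣∁p∣≡n V⟨ Y ⟩) ⟨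
      (a + ∣ ∁ V⟨ Y ⟩ ∣) + n       ≡⟨ +-assoc a _ n ⟩
      a + (∣ ∁ V⟨ Y ⟩ ∣ + n)       ≡⟨ cong (a +_) (+-comm _ n) ⟩
      a + (n + ∣ ∁ V⟨ Y ⟩ ∣)       ≡⟨ +-assoc a n _ ⟨
      (a + n) + ∣ ∁ V⟨ Y ⟩ ∣       ∎)
      where
      open ≤-Reasoning
      a = ∣ V⟨ Y ⟩ ∣
      n = ν (⊤ - x)

-- Bases and cocircuits of M k G

module MatroidDecidability (k : ℕ) (G : Graph) where
  open Graph G
  open Matroid (M k G)

  circuit? : Decidable Circuit
  circuit? = minimal? (tight? k G)

  independent? : Decidable Independent
  independent? X = map′ (λ none C circ C⊆X → none (C , circ , λ {_} → C⊆X))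
                        (λ ind (C , circ , C⊆X) → ind C circ C⊆X)
                        (¬? (anySubset? (λ C → circuit? C ×-dec (C ⊆? X))))

  coIndependent? : Decidable CoIndependent
  coIndependent? X = anySubset? (λ B → maximal? independent? (∁ B) ×-dec (X ⊆? B))

  -- A circuit touches a vertex and hence has at least `1 + k` edges.
  singleton-independent : 1 ≤ k → ∀ e → Independent ⁅ e ⁆
  singleton-independent 1≤k e C ((ne@(x , x∈C) , eq) , _) C⊆ = <-irrefl refl (begin-strict
    1                      ≡⟨⟩
    1 + 0                  <⟨ +-mono-≤-< (nonempty⇒0<∣p∣ (_ , ∈V⁺ G {C} x∈C (inj₁ refl))) 1≤k ⟩
    ∣ V⟨ C ⟩ ∣ + k         ≡⟨ eq ⟨
    ∣ C ∣                  ≤⟨ p⊆q⇒∣p∣≤∣q∣ C⊆ ⟩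
    ∣ ⁅ e ⁆ ∣              ≡⟨ ∣⁅x⁆∣≡1 e ⟩
    1                      ∎)
    where open ≤-Reasoning

  -- Otherwise the empty set would be a base, although `⁅ e ⁆` is independent.
  ⊤-not-coIndependent : 1 ≤ k → Fin #E → ¬ CoIndependent ⊤
  ⊤-not-coIndependent 1≤k e (B , (_ , max) , ⊤⊆B) =
    x∈p⇒x∉∁p (⊤⊆B ∈⊤) (subst (e ∈_) (max ⁅ e ⁆ (singleton-independent 1≤k e) ∁B⊆) (x∈⁅x⁆ e))
    where
    ∁B⊆ : ∁ B ⊆ ⁅ e ⁆
    ∁B⊆ x∈ = contradiction (⊤⊆B ∈⊤) (x∈∁p⇒x∉p x∈)

  cocircuit-exists : 1 ≤ k → Fin #E → ∃ Cocircuit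
  cocircuit-exists 1≤k e =
    let D , cocircuit , _ = ∃-minimal (¬? ∘ coIndependent?) _ ⊤ ≤-refl (⊤-not-coIndependent 1≤k e)
    in D , cocircuit

-- Edges that no circuit contains

module Circuits (k : ℕ) (1≤k : 1 ≤ k) (G : Graph) where
  open Graph G
  open GraphBasics G

  -- Deleting Z would keep C dense.
  circuit-loses-few-vertices : ∀ {C Z U} → MkCircuit k G C → Nonempty Z → Z ⊆ C → U ⊆ V⟨ C ⟩ →
                               (∀ {v} → v ∈ V⟨ C ─ Z ⟩ → v ∉ U) → ¬ ∣ Z ∣ ≤ ∣ U ∣
  circuit-loses-few-vertices {C} {Z} {U} circ@((_ , eq) , _) (z , z∈Z) Z⊆C U⊆V disj ∣Z∣≤∣U∣ =
    <⇒≱ (proper⇒sparse k G circ (C ─ Z) (p─q⊆p C Z) proper (0<∣p∣⇒nonempty positive)) dense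
    where
    open ≤-Reasoning
    rest : ℕ
    rest = ∣ V⟨ C ─ Z ⟩ ∣
    dense : rest + k ≤ ∣ C ─ Z ∣
    dense = +-cancelʳ-≤ ∣ U ∣ _ _ (begin
      (rest + k) + ∣ U ∣      ≡⟨ +-assoc rest k _ ⟩
      rest + (k + ∣ U ∣)      ≡⟨ cong (rest +_) (+-comm k _) ⟩
      rest + (∣ U ∣ + k)      ≡⟨ +-assoc rest _ k ⟨
      (rest + ∣ U ∣) + k      ≤⟨ +-monoˡ-≤ k (disjoint⇒∣p∣+∣q∣≤∣r∣ (V-mono G (p─q⊆p C Z)) U⊆V disj) ⟩
      ∣ V⟨ C ⟩ ∣ + k          ≡⟨ eq ⟨
      ∣ C ∣                   ≤⟨ ∣p∣≤∣p─q∣+∣q∣ C Z ⟩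
      ∣ C ─ Z ∣ + ∣ Z ∣       ≤⟨ +-monoʳ-≤ ∣ C ─ Z ∣ ∣Z∣≤∣U∣ ⟩
      ∣ C ─ Z ∣ + ∣ U ∣       ∎)
    -- Density with `1 ≤ k` guarantees that some edge survives, as `proper⇒sparse` demands.
    positive : 0 < ∣ C ─ Z ∣
    positive = <-≤-trans 1≤k (≤-trans (m≤n+m k rest) dense)
    proper : C ─ Z ≢ C
    proper eq = x∈p─q⇒x∉q C Z (subst (z ∈_) (sym eq) (Z⊆C z∈Z)) z∈Z

  -- Deleting `e` also removes `v`: one edge against one vertex.
  leaf-edge∉circuit : ∀ {C v e} → MkCircuit k G C → Incident e v → (∀ f → Incident f v → f ≡ e) → e ∉ C
  leaf-edge∉circuit {C} {v} {e} circ inc only e∈C =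
    circuit-loses-few-vertices {Z = ⁅ e ⁆} {U = ⁅ v ⁆} circ (e , x∈⁅x⁆ e)
      (λ x∈ → subst (_∈ C) (sym (x∈⁅y⁆⇒x≡y e x∈)) e∈C)
      (λ w∈ → subst (_∈ V⟨ C ⟩) (sym (x∈⁅y⁆⇒x≡y v w∈)) (∈V⁺ G e∈C inc))
      disj (≤-reflexive (trans (∣⁅x⁆∣≡1 e) (sym (∣⁅x⁆∣≡1 v))))
    where
    disj : ∀ {w} → w ∈ V⟨ C ─ ⁅ e ⁆ ⟩ → w ∉ ⁅ v ⁆
    disj w∈ w∈v with x∈⁅y⁆⇒x≡y v w∈v
    ... | refl =
      let f , f∈ , inc-f = ∈V⁻ G w∈
      in x∉p-x C e (subst (_∈ C - e) (only f inc-f) f∈)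

  -- Adding `g` and its ends to `H` keeps it connected, every vertex having a walk to `v`;
  -- maximality of `H` then absorbs `g`.
  component-saturated : ∀ H → IsComponent H → ∀ {g v} → v ∈ V H → Incident g v → g ∈ E H
  component-saturated H ((_ , H-connected) , maximal) {g} {v} v∈H inc =
    proj₂ (maximal K ((v , ∈comprehension⁺ V? (inj₁ v∈H)) , K-connected) (V⊆ , E⊆))
      (∈comprehension⁺ E? (inj₂ refl))
    where
    V? : Decidable (λ u → u ∈ V H ⊎ Incident g u)
    V? u = (u ∈? V H) ⊎-dec incident? g u
    E? : Decidable (λ e → e ∈ E H ⊎ e ≡ g)
    E? e = (e ∈? E H) ⊎-dec (e ≟F g)
    K : Subgraph
    K = record
      { V      = comprehension V?
      ; E      = comprehension E?
      ; closed = λ e∈ inc-e → ∈comprehension⁺ V? (ends-in (∈comprehension⁻ E? e∈) inc-e)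
      }
      where
      ends-in : ∀ {e u} → e ∈ E H ⊎ e ≡ g → Incident e u → u ∈ V H ⊎ Incident g u
      ends-in (inj₁ e∈)   inc-e = inj₁ (closed H e∈ inc-e)
      ends-in (inj₂ refl) inc-e = inj₂ inc-e
    V⊆ : V H ⊆ V K
    V⊆ u∈ = ∈comprehension⁺ V? (inj₁ u∈)
    E⊆ : E H ⊆ E K
    E⊆ e∈ = ∈comprehension⁺ E? (inj₁ e∈)
    to-v : ∀ {u} → u ∈ V H ⊎ Incident g u → Star (Adjacent K) u v
    to-v (inj₁ u∈) = Star.map (λ (e , e∈ , joins) → e , E⊆ e∈ , joins) (H-connected u∈ v∈H)
    to-v (inj₂ inc-u) with otherEnd inc
    ... | w , joins with Joins-Incident joins inc-u
    ...   | inj₁ refl = (g , ∈comprehension⁺ E? (inj₂ refl) , joins) ◅ ε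
    ...   | inj₂ refl = ε
    K-connected : ∀ {u w} → u ∈ V K → w ∈ V K → Star (Adjacent K) u w
    K-connected u∈ w∈ = to-v (∈comprehension⁻ V? u∈) ◅◅ reverse (Adjacent-sym K) (to-v (∈comprehension⁻ V? w∈))

  -- Sending each cycle edge in `C` to the vertex of the same index is injective, so these edges
  -- touch at least as many vertices. All of those disappear with them, since every edge at such a
  -- vertex belongs to `H`.
  cycle-component-edge∉circuit : ∀ {C e} H → IsComponent H → IsCycle H → MkCircuit k G C → e ∈ E H → e ∉ C
  cycle-component-edge∉circuit {C} {e} H isComp isCyc circ e∈H e∈C =
    circuit-loses-few-vertices circ (e , x∈p∩q⁺ (e∈C , e∈H)) (p∩q⊆p C (E H)) (V-mono G (p∩q⊆p C (E H))) disj
      (injection⇒∣p∣≤∣q∣ Z V⟨ Z ⟩ (λ f f∈ → vertex (index f∈)) in-V injective)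
    where
    open IsCycle isCyc
    Z : Subset #E
    Z = C ∩ E H

    on-cycle : ∀ {f} → f ∈ Z → ∃[ i ] edge i ≡ f
    on-cycle {f} f∈ = Equivalence.to (edges f) (p∩q⊆q C (E H) f∈)
    index : ∀ {f} → f ∈ Z → Fin (suc ℓ)
    index f∈ = proj₁ (on-cycle f∈)
    edge-index : ∀ {f} (f∈ : f ∈ Z) → edge (index f∈) ≡ f
    edge-index f∈ = proj₂ (on-cycle f∈)

    incident : ∀ i → Incident (edge i) (vertex i)
    incident i with view i
    ... | ‵fromℕ     = Joins⇒Incident closing
    ... | ‵inject₁ j = Joins⇒Incident (consecutive j)

    in-V : ∀ f f∈ → vertex (index {f} f∈) ∈ V⟨ Z ⟩
    in-V f f∈ = ∈V⁺ G f∈ (subst (λ g → Incident g (vertex (index f∈))) (edge-index f∈) (incident (index f∈)))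

    injective : ∀ f g f∈ g∈ → vertex (index {f} f∈) ≡ vertex (index {g} g∈) → f ≡ g
    injective f g f∈ g∈ eq = trans (sym (edge-index f∈)) (trans (cong edge (vertex-inj eq)) (edge-index g∈))

    disj : ∀ {v} → v ∈ V⟨ C ─ Z ⟩ → v ∉ V⟨ Z ⟩
    disj v∈ v∈Z =
      let f , f∈Z , inc-f = ∈V⁻ G v∈Z
          g , g∈ , inc-g  = ∈V⁻ G v∈
          g∈H = component-saturated H isComp (closed H (p∩q⊆q C (E H) f∈Z) inc-f) inc-g
      in x∈p─q⇒x∉q C Z g∈ (x∈p∩q⁺ (p─q⊆p C Z g∈ , g∈H))

-- The two implications

∃-distinct : ∀ {n} → 2 ≤ n → (x : Fin n) → ∃[ y ] x ≢ y
∃-distinct (s≤s (s≤s _)) x = punchIn x zero , λ eq → punchInᵢ≢i x zero (sym eq)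

module _ (G : Graph) (k : ℕ) (2≤k : 2 ≤ k) where
  open Graph G
  open Nullity G
  1≤k : 1 ≤ k
  1≤k = ≤-trans (s≤s z≤n) 2≤k

  open Circuits k 1≤k G

  cacti⇒connected : Matroid.NonTrivial (M k G) × IsCacti → Matroid.Connected (M k G)
  cacti⇒connected (((C , ((ne , eq) , _)) , _) , cacti) =
    2≤#E , λ x y _ → common-circuit 2≤k k≤ν (Cycles.cacti⇒NonColoop G cacti x) (Cycles.cacti⇒NonColoop G cacti y)
    where
    2≤#E : 2 ≤ #E
    2≤#E = ≤-trans 2≤k (≤-trans (m≤n+m k ∣ V⟨ C ⟩ ∣) (≤-trans (≤-reflexive (sym eq)) (∣p∣≤n C)))
    -- A circuit is a set of excess exactly `k`.
    k≤ν : k ≤ ν ⊤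
    k≤ν = +-cancelˡ-≤ ∣ V⟨ C ⟩ ∣ _ _ (≤-trans (≤-reflexive (sym eq)) (∣Y∣≤∣V∣+ν ⊆⊤))

  -- Pairing an edge with any other one puts it in a circuit, which rules out leaf edges and edges
  -- of cycle components.
  connected⇒cacti : Matroid.Connected (M k G) → Matroid.NonTrivial (M k G) × IsCacti
  connected⇒cacti (2≤#E , common) =
    (circuit-exists , MatroidDecidability.cocircuit-exists k G 1≤k e₀) , noLeaf , noCycle
    where
    circuit-through : ∀ e → ∃[ C ] MkCircuit k G C × e ∈ C
    circuit-through e =
      let f , e≢f = ∃-distinct 2≤#E e
          C , circ , e∈C , _ = common e f e≢f
      in C , circ , e∈C
    e₀ : Fin #E
    e₀ = fromℕ< (<-≤-trans (s≤s z≤n) 2≤#E)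
    circuit-exists : ∃ (MkCircuit k G)
    circuit-exists = proj₁ (circuit-through e₀) , proj₁ (proj₂ (circuit-through e₀))
    noLeaf : ∀ v → ¬ IsLeaf v
    noLeaf v (e , inc , _ , only) =
      let C , circ , e∈C = circuit-through e
      in leaf-edge∉circuit circ inc only e∈C
    noCycle : ∀ H → IsComponent H → ¬ IsCycle H
    noCycle H isComp isCyc =
      let e = IsCycle.edge isCyc zero
          C , circ , e∈C = circuit-through e
      in cycle-component-edge∉circuit H isComp isCyc circ (Equivalence.from (IsCycle.edges isCyc e) (zero , refl)) e∈C

mainTheorem13 : (G : Graph) (k : ℕ) → 2 ≤ k →
    (Matroid.NonTrivial (M k G) × Graph.IsCacti G) ⇔ Matroid.Connected (M k G)
mainTheorem13 G k 2≤k = mk⇔ (cacti⇒connected G k 2≤k) (connected⇒cacti G k 2≤k)
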